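{- There exists an integer $k_0$ such that for all integers $k\ge k_0$ the following holds. If $X\subseteq\{0,1\}^k$ is an arbitrary set of vertices of the cube with $|X|\ge 2$, then there exists a Hamiltonian cycle $H$ through $X$ such that $s_k(H)\le 2^{1/k}\sqrt{k}$.
   Context: $|x-y|$ denotes Euclidean distance. A Hamiltonian cycle (tour) $H$ through an $n$-element set $X$, $n\ge 2$, is a cyclic ordering $x_1,\ldots,x_n$ of all points of $X$, with edges $x_ix_{i+1}$, $i=1,\ldots,n$, where $x_{n+1}:=x_1$ (so for $n=2$ the single segment is counted twice). Its scaled cost is $s_k(H)=\left(\sum_{i=1}^n|x_i-x_{i+1}|^k\right)^{1/k}$. -}

module Defs where

import Algebra.Definitions.RawSemiring
open import Data.Fin.Base using (Fin; toℕ)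
open import Data.Integer.Base using (+_)
open import Data.List.Base using (List; []; _∷_; _∷ʳ_; foldr; map; zip)
open import Data.List.Relation.Binary.Permutation.Propositional using (_↭_)
open import Data.Nat.Base as ℕ using (ℕ; zero; suc; NonZero)
open import Data.Product.Base using (_×_; _,_; proj₁; proj₂; ∃-syntax)
open import Data.Rational.Base as ℚ using (ℚ; 0ℚ; 1ℚ)
import Data.Rational.Properties as ℚₚ
open import Data.Vec.Base as Vec using (Vec)
open import Relation.Binary.PropositionalEquality using (_≡_; refl; subst)

-- A nonnegative real x is represented by its upper cut, the set of
-- rationals q with x < q.

record ℝ≥0 : Set₁ where
  field
    Above     : ℚ → Set
    inhabited : ∃[ q ] Above q
    positive  : ∀ {q} → Above q → 0ℚ ℚ.< q
    upward    : ∀ {p q} → Above p → p ℚ.< q → Above q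
    open-cut  : ∀ {q} → Above q → ∃[ p ] (Above p × p ℚ.< q)

open ℝ≥0 public

infix 4 _≤_

_≤_ : ℝ≥0 → ℝ≥0 → Set
x ≤ y = ∀ q → Above y q → Above x q

-- The infimum of an inhabited set P of nonnegative rationals.

private
  p<p+1 : ∀ p → p ℚ.< p ℚ.+ 1ℚ
  p<p+1 p = subst (ℚ._< p ℚ.+ 1ℚ) (ℚₚ.+-identityʳ p)
                  (ℚₚ.+-monoʳ-< p (ℚₚ.positive⁻¹ 1ℚ))

inf : (P : ℚ → Set) → ∃[ p ] P p → (∀ {p} → P p → 0ℚ ℚ.≤ p) → ℝ≥0
inf P (p₀ , Pp₀) nonneg = record
  { Above     = λ q → ∃[ p ] (P p × p ℚ.< q)
  ; inhabited = p₀ ℚ.+ 1ℚ , p₀ , Pp₀ , p<p+1 p₀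
  ; positive  = λ { (p , Pp , p<q) → ℚₚ.≤-<-trans (nonneg Pp) p<q }
  ; upward    = λ { (p , Pp , p<q) q<r → p , Pp , ℚₚ.<-trans p<q q<r }
  ; open-cut  = λ { (p , Pp , p<q) → let (m , p<m , m<q) = ℚₚ.<-dense p<q
                                     in m , (p , Pp , p<m) , m<q }
  }

fromℕ : ℕ → ℝ≥0
fromℕ n = inf (λ p → p ≡ + n ℚ./ 1) (+ n ℚ./ 1 , refl)
  λ { refl → ℚₚ.nonNegative⁻¹ (+ n ℚ./ 1) {{ℚₚ.normalize-nonNeg n 1}} }

infixl 6 _+_
infixl 7 _*_
infixr 8 _^_

_+_ : ℝ≥0 → ℝ≥0 → ℝ≥0
x + y = inf (λ p → ∃[ a ] ∃[ b ] (Above x a × Above y b × p ≡ a ℚ.+ b))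
  (let (a , x<a) = inhabited x ; (b , y<b) = inhabited y
   in a ℚ.+ b , a , b , x<a , y<b , refl)
  λ { (a , b , x<a , y<b , refl) →
        ℚₚ.<⇒≤ (ℚₚ.+-mono-< (positive x x<a) (positive y y<b)) }

_*_ : ℝ≥0 → ℝ≥0 → ℝ≥0
x * y = inf (λ p → ∃[ a ] ∃[ b ] (Above x a × Above y b × p ≡ a ℚ.* b))
  (let (a , x<a) = inhabited x ; (b , y<b) = inhabited y
   in a ℚ.* b , a , b , x<a , y<b , refl)
  λ { (a , b , x<a , y<b , refl) →
        ℚₚ.<⇒≤ (ℚₚ.positive⁻¹ (a ℚ.* b)
          {{ℚₚ.pos*pos⇒pos a {{ℚ.positive (positive x x<a)}}
                           b {{ℚ.positive (positive y y<b)}}}}) }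

_^_ : ℝ≥0 → ℕ → ℝ≥0
x ^ zero  = fromℕ 1
x ^ suc n = x * x ^ n

open Algebra.Definitions.RawSemiring ℚₚ.+-*-rawSemiring
  using () renaming (_^_ to _^ℚ_)

private
  1≤^ : ∀ p → 1ℚ ℚ.≤ p → ∀ n → 1ℚ ℚ.≤ p ^ℚ n
  p≤^ : ∀ p → 1ℚ ℚ.≤ p → ∀ n → p ℚ.≤ p ^ℚ suc n
  1≤^ p 1≤p zero    = ℚₚ.≤-refl
  1≤^ p 1≤p (suc n) = ℚₚ.≤-trans 1≤p (p≤^ p 1≤p n)
  p≤^ p 1≤p n = subst (ℚ._≤ p ^ℚ suc n) (ℚₚ.*-identityʳ p)
    (ℚₚ.*-monoˡ-≤-nonNeg p {{ℚ.nonNegative (ℚₚ.≤-trans (ℚₚ.nonNegative⁻¹ 1ℚ) 1≤p)}}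
      (1≤^ p 1≤p n))

-- root k x = x^{1/k} is the infimum of the rationals p ≥ 0 with x < p^k.

root : (k : ℕ) .{{_ : NonZero k}} → ℝ≥0 → ℝ≥0
root k@(suc n) x = inf (λ p → 0ℚ ℚ.≤ p × Above x (p ^ℚ k))
  (let (r , x<r) = inhabited x
       0≤r       = ℚₚ.<⇒≤ (positive x x<r)
       p         = r ℚ.+ 1ℚ
       1≤p       = subst (ℚ._≤ p) (ℚₚ.+-identityˡ 1ℚ) (ℚₚ.+-monoˡ-≤ 1ℚ 0≤r)
   in p , ℚₚ.≤-trans (ℚₚ.nonNegative⁻¹ 1ℚ) 1≤p
        , upward x x<r (ℚₚ.<-≤-trans (p<p+1 r) (p≤^ p 1≤p n)))
  proj₁

√ : ℝ≥0 → ℝ≥0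
√ = root 2

sum : List ℝ≥0 → ℝ≥0
sum = foldr _+_ (fromℕ 0)

Vertex : ℕ → Set
Vertex k = Vec (Fin 2) k

-- Coordinates are natural numbers, so squared distances are too; ∣_-_∣ is the
-- absolute difference.

dist : ∀ {k} → Vertex k → Vertex k → ℝ≥0
dist x y = √ (fromℕ (Vec.sum (Vec.zipWith (λ a b → ℕ.∣ toℕ a - toℕ b ∣ ℕ.^ 2) x y)))

-- A finite set of vertices is a list without repetitions; a Hamiltonian cycle
-- through it is an enumeration of the same vertices, read cyclically.

record HamiltonianCycle {k} (X : List (Vertex k)) : Set where
  field
    tour   : List (Vertex k)
    tour↭X : tour ↭ X

open HamiltonianCycle public

-- x₁x₂, …, xₙ₋₁xₙ, xₙx₁; for n = 2 the segment occurs twice.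

cyclicEdges : ∀ {A : Set} → List A → List (A × A)
cyclicEdges []       = []
cyclicEdges (x ∷ xs) = zip (x ∷ xs) (xs ∷ʳ x)

scaledCost : ∀ {k} .{{_ : NonZero k}} {X : List (Vertex k)} → HamiltonianCycle X → ℝ≥0
scaledCost {k} H =
  root k (sum (map (λ (x , y) → dist x y ^ k) (cyclicEdges (tour H))))

{-# OPTIONS --safe #-}

-- In terms of the Hamming distance h the claim reads Σ (h/k)^{k/2} ≤ 2 over the
-- edges of a suitable tour.  Start with single points as paths and repeatedly
-- connect the first vertices of two paths.  Among more than 2·2^j vertices three
-- agree in the first j coordinates, and two of those are at distance at most
-- 2(k − j)/3.  Hence, for j = i(⌊k/6⌋ + 1) and i = 5, …, 0, all but 2·2^j paths can
-- be eliminated by edges with (h/k)^{k/2} ≤ ((6 − i)/9)^{k/2}; there are only about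
-- 2^{(i+1)k/6} of them, so they contribute exponentially little, and finally two
-- paths remain.  These can be closed up in two ways.  If one of the two ways uses
-- at most one antipodal pair, it costs at most 1 + 2/3.  Otherwise each path
-- consists of one point, and the cost is exactly 2.

module Submission where

open import Defs
open import Algebra.Bundles using (CommutativeRing)
import Algebra.Definitions.RawSemiring
import Algebra.Properties.CommutativeSemiring.Exp
open import Data.Fin.Base using (Fin; toℕ; zero; suc; fromℕ<)
import Data.Fin.Properties as Finₚ
open import Data.Integer.Base as ℤ using (+_)
import Data.Integer.Properties as ℤₚ
open import Data.List.Base
  using (List; []; _∷_; _++_; _∷ʳ_; length; map; concatMap; zip)
import Data.List.Properties as Listₚ
open import Data.List.Relation.Binary.Permutation.Propositional
  using (_↭_; ↭-refl; ↭-sym; ↭-trans; ↭-reflexive; prep; swap; ↭⇒↭ₛ; module PermutationReasoning)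
import Data.List.Relation.Binary.Permutation.Propositional.Properties as ↭ₚ
import Data.List.Relation.Binary.Permutation.Setoid.Properties as ↭ₛₚ
open import Data.List.Relation.Unary.All using (All; []; _∷_)
import Data.List.Relation.Unary.All.Properties as Allₚ
open import Data.List.Relation.Unary.AllPairs using ([]; _∷_)
open import Data.List.Relation.Unary.Unique.Propositional using (Unique)
open import Data.Nat.Base as ℕ using (ℕ; zero; suc; NonZero; s≤s; z≤n)
import Data.Nat.DivMod as DivMod
open import Data.Nat.ListAction using () renaming (sum to sumℕ)
open import Data.Nat.ListAction.Properties using (sum-↭)
import Data.Nat.Properties as ℕₚ
open import Data.Nat.Solver using (module +-*-Solver)
open import Data.Product.Base using (_×_; _,_; proj₁; proj₂; ∃-syntax)
open import Data.Rational.Base as ℚ using (ℚ; 0ℚ)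
import Data.Rational.Properties as ℚₚ
open import Data.Rational.Unnormalised.Base as ℚᵘ using (mkℚᵘ)
import Data.Rational.Unnormalised.Properties as ℚᵘₚ
open import Data.Sum.Base using (_⊎_; inj₁; inj₂)
open import Data.Vec.Base as Vec using (Vec; []; _∷_)
open import Function.Base using (_∘_)
open import Relation.Binary.PropositionalEquality
open import Relation.Nullary using (¬_; Dec; yes; no; contradiction; from-yes; _×-dec_)

open Algebra.Definitions.RawSemiring ℚₚ.+-*-rawSemiring
  using () renaming (_^_ to _^ℚ_)
open Algebra.Properties.CommutativeSemiring.Exp
  (CommutativeRing.commutativeSemiring ℚₚ.+-*-commutativeRing)
  using () renaming (^-distrib-* to ^ℚ-distrib-*)

-- Rational upper bounds of nonnegative reals

-- This is literally the radicand in `dist`, so `dist x y` unfolds to `√ (fromℕ (hamming x y))`.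
-- Since each coordinate is 0 or 1, it counts the coordinates in which the vertices differ.
hamming : ∀ {k} → Vertex k → Vertex k → ℕ
hamming x y = Vec.sum (Vec.zipWith (λ a b → ℕ.∣ toℕ a - toℕ b ∣ ℕ.^ 2) x y)

ι : ℕ → ℚ
ι n = + n ℚ./ 1

-- Rationals are kept in lowest terms, so `ι` does not commute with arithmetic by computation. The
-- laws are therefore proved for unnormalised fractions with denominator 1 and carried back.
toℚᵘ-ι : ∀ n → ℚ.toℚᵘ (ι n) ℚᵘ.≃ mkℚᵘ (+ n) 0
toℚᵘ-ι n = ℚₚ.toℚᵘ-fromℚᵘ (mkℚᵘ (+ n) 0)

ι-+ : ∀ m n → ι (m ℕ.+ n) ≡ ι m ℚ.+ ι n
ι-+ m n = ℚₚ.toℚᵘ-injective (begin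
  ℚ.toℚᵘ (ι (m ℕ.+ n))                 ≈⟨ toℚᵘ-ι (m ℕ.+ n) ⟩
  mkℚᵘ (+ (m ℕ.+ n)) 0                 ≈⟨ ℚᵘ.*≡* (cong (ℤ._* + 1)
    (cong₂ ℤ._+_ (sym (ℤₚ.*-identityʳ (+ m))) (sym (ℤₚ.*-identityʳ (+ n))))) ⟩
  mkℚᵘ (+ m) 0 ℚᵘ.+ mkℚᵘ (+ n) 0       ≈⟨ ℚᵘₚ.+-cong (toℚᵘ-ι m) (toℚᵘ-ι n) ⟨
  ℚ.toℚᵘ (ι m) ℚᵘ.+ ℚ.toℚᵘ (ι n)       ≈⟨ ℚₚ.toℚᵘ-homo-+ (ι m) (ι n) ⟨
  ℚ.toℚᵘ (ι m ℚ.+ ι n)                 ∎)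
  where
  open import Relation.Binary.Reasoning.Setoid ℚᵘₚ.≃-setoid

ι-* : ∀ m n → ι (m ℕ.* n) ≡ ι m ℚ.* ι n
ι-* m n = ℚₚ.toℚᵘ-injective (begin
  ℚ.toℚᵘ (ι (m ℕ.* n))                 ≈⟨ toℚᵘ-ι (m ℕ.* n) ⟩
  mkℚᵘ (+ (m ℕ.* n)) 0                 ≈⟨ ℚᵘ.*≡* (cong (ℤ._* + 1) (ℤₚ.pos-* m n)) ⟩
  mkℚᵘ (+ m) 0 ℚᵘ.* mkℚᵘ (+ n) 0       ≈⟨ ℚᵘₚ.*-cong (toℚᵘ-ι m) (toℚᵘ-ι n) ⟨
  ℚ.toℚᵘ (ι m) ℚᵘ.* ℚ.toℚᵘ (ι n)       ≈⟨ ℚₚ.toℚᵘ-homo-* (ι m) (ι n) ⟨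
  ℚ.toℚᵘ (ι m ℚ.* ι n)                 ∎)
  where
  open import Relation.Binary.Reasoning.Setoid ℚᵘₚ.≃-setoid

ι-^ : ∀ m n → ι (m ℕ.^ n) ≡ ι m ^ℚ n
ι-^ m zero    = refl
ι-^ m (suc n) = trans (ι-* m (m ℕ.^ n)) (cong (ι m ℚ.*_) (ι-^ m n))

ι-nonNeg : ∀ n → ℚ.NonNegative (ι n)
ι-nonNeg n = ℚₚ.normalize-nonNeg n 1

0≤ι : ∀ n → 0ℚ ℚ.≤ ι n
0≤ι n = ℚₚ.nonNegative⁻¹ (ι n) {{ι-nonNeg n}}

ι-pos : ∀ n .{{_ : NonZero n}} → ℚ.Positive (ι n)
ι-pos n = ℚₚ.normalize-pos n 1

ι-mono-≤ : ∀ {m n} → m ℕ.≤ n → ι m ℚ.≤ ι n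
ι-mono-≤ {m} {n} m≤n = begin
  ι m                    ≡⟨ ℚₚ.+-identityʳ (ι m) ⟨
  ι m ℚ.+ 0ℚ             ≤⟨ ℚₚ.+-monoʳ-≤ (ι m) (0≤ι (n ℕ.∸ m)) ⟩
  ι m ℚ.+ ι (n ℕ.∸ m)    ≡⟨ ι-+ m (n ℕ.∸ m) ⟨
  ι (m ℕ.+ (n ℕ.∸ m))    ≡⟨ cong ι (ℕₚ.m+[n∸m]≡n m≤n) ⟩
  ι n                    ∎
  where
  open ℚₚ.≤-Reasoning

^ℚ-pos : ∀ p .{{_ : ℚ.Positive p}} n → ℚ.Positive (p ^ℚ n)
^ℚ-pos p zero    = _
^ℚ-pos p (suc n) = ℚₚ.pos*pos⇒pos p (p ^ℚ n) {{^ℚ-pos p n}}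

-- The non-strict relation x ≤ p for a rational p. Cuts are open, so `Above x p` would say x < p and
-- would exclude exact values such as `ι n` for `fromℕ n`.
UpperBound : ℝ≥0 → ℚ → Set
UpperBound x p = ∀ {q} → p ℚ.< q → Above x q

fromℕ-upperBound : ∀ n → UpperBound (fromℕ n) (ι n)
fromℕ-upperBound n n<q = ι n , refl , n<q

Above-fromℕ⁻ : ∀ {n q} → Above (fromℕ n) q → ι n ℚ.< q
Above-fromℕ⁻ (_ , refl , n<q) = n<q

-- The slack between p + r and q is divided: `m` leaves room below q, and `s` lies between p and m -
-- r, so that the other summand m - s still exceeds r.
+-upperBound : ∀ {x y p r} → UpperBound x p → UpperBound y r →
               UpperBound (x + y) (p ℚ.+ r)
+-upperBound {p = p} {r} x≤p y≤r {q} p+r<q =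
  let (m , p+r<m , m<q) = ℚₚ.<-dense p+r<q
      p<m-r = subst (ℚ._< m ℚ.- r) (cancel p r) (ℚₚ.+-monoˡ-< (ℚ.- r) p+r<m)
      (s , p<s , s<m-r) = ℚₚ.<-dense p<m-r
      r<m-s = subst₂ ℚ._<_ (cancelˡ s r) (cong (ℚ._- s) (restore m r))
                (ℚₚ.+-monoˡ-< (ℚ.- s) (ℚₚ.+-monoˡ-< r s<m-r))
  in m , (s , m ℚ.- s , x≤p p<s , y≤r r<m-s ,
          sym (trans (ℚₚ.+-comm s (m ℚ.- s)) (restore m s))) , m<q
  where
  cancel : ∀ a b → a ℚ.+ b ℚ.- b ≡ a
  cancel a b = trans (ℚₚ.+-assoc a b (ℚ.- b))
    (trans (cong (a ℚ.+_) (ℚₚ.+-inverseʳ b)) (ℚₚ.+-identityʳ a))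
  cancelˡ : ∀ a b → a ℚ.+ b ℚ.- a ≡ b
  cancelˡ a b = trans (cong (ℚ._- a) (ℚₚ.+-comm a b)) (cancel b a)
  restore : ∀ a b → a ℚ.- b ℚ.+ b ≡ a
  restore a b = trans (ℚₚ.+-assoc a (ℚ.- b) b)
    (trans (cong (a ℚ.+_) (ℚₚ.+-inverseˡ b)) (ℚₚ.+-identityʳ a))

-- The strict bound `a` of the first factor is positive, so q can be divided by it: q / a lies above
-- y. Lowering `a` to `a₁` then makes the product strictly less than q.
*-upperBound : ∀ {x y a p} → Above x a → UpperBound y p →
               UpperBound (x * y) (a ℚ.* p)
*-upperBound {x} {y} {a} {p} x<a y≤p {q} ap<q =
  let (a₁ , x<a₁ , a₁<a) = open-cut x x<a
  in a₁ ℚ.* b , (a₁ , b , x<a₁ , y<b , refl) ,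
     subst (a₁ ℚ.* b ℚ.<_) ab≡q
       (ℚₚ.*-monoˡ-<-pos b {{ℚ.positive (positive y y<b)}} a₁<a)
  where
  instance
    a-pos : ℚ.Positive a
    a-pos = ℚ.positive (positive x x<a)
    a-nonZero : ℚ.NonZero a
    a-nonZero = ℚₚ.pos⇒nonZero a
    a-nonNeg : ℚ.NonNegative a
    a-nonNeg = ℚₚ.pos⇒nonNeg a
  b = ℚ.1/ a ℚ.* q
  ab≡q : a ℚ.* b ≡ q
  ab≡q = trans (sym (ℚₚ.*-assoc a (ℚ.1/ a) q))
    (trans (cong (ℚ._* q) (ℚₚ.*-inverseʳ a)) (ℚₚ.*-identityˡ q))
  y<b : Above y b
  y<b = y≤p (ℚₚ.*-cancelˡ-<-nonNeg a (subst (a ℚ.* p ℚ.<_) (sym ab≡q) ap<q))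

-- The conclusion is only non-strict because of the exponent 0, where both sides equal 1.
^-upperBound : ∀ {x a} → Above x a → ∀ n → UpperBound (x ^ n) (a ^ℚ n)
^-upperBound x<a zero    = fromℕ-upperBound 1
^-upperBound {x} x<a (suc n) = *-upperBound {x} {x ^ n} x<a (^-upperBound {x} x<a n)

sum-upperBound : ∀ {A : Set} (x : A → ℝ≥0) (c : A → ℕ) s →
                 (∀ a → UpperBound (x a) (s ℚ.* ι (c a))) → ∀ as →
                 UpperBound (sum (map x as)) (s ℚ.* ι (sumℕ (map c as)))
sum-upperBound x c s x≤c []       {q} lt =
  fromℕ-upperBound 0 (subst (ℚ._< q) (ℚₚ.*-zeroʳ s) lt)
sum-upperBound x c s x≤c (a ∷ as) {q} lt =
  +-upperBound {x a} {sum (map x as)} (x≤c a) (sum-upperBound x c s x≤c as)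
    (subst (ℚ._< q) (trans (cong (s ℚ.*_) (ι-+ (c a) _))
                           (ℚₚ.*-distribˡ-+ s (ι (c a)) _)) lt)

-- The scale 1/D turns the integers e x y into rational upper bounds of the
-- distances relative to √k.

scaledCost-bound :
  ∀ {k} .{{_ : NonZero k}} {X : List (Vertex k)} (H : HamiltonianCycle X)
  (D : ℕ) .{{_ : NonZero D}} (e : Vertex k → Vertex k → ℕ) →
  (∀ x y → 0 ℕ.< e x y) →
  (∀ x y → hamming x y ℕ.* D ℕ.^ 2 ℕ.≤ k ℕ.* e x y ℕ.^ 2) →
  sumℕ (map (λ (x , y) → e x y ℕ.^ k) (cyclicEdges (tour H))) ℕ.≤ 2 ℕ.* D ℕ.^ k →
  scaledCost H ≤ root k (fromℕ 2) * √ (fromℕ k)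
scaledCost-bound {k@(suc _)} H D e 0<e e-bound total q
  (_ , (a₁ , b₁ , (a , (0≤a , 2<aᵏ) , a<a₁) , (b , (0≤b , k<b²) , b<b₁) , refl) , a₁b₁<q)
  -- Here a < a₁ and b < b₁ are the rationals that witness the two roots. The product a b₁ is below
  -- a₁ b₁ < q. The gap between b and b₁ makes each distance strictly less than b₁ e / D, and 2 <
  -- a^k makes the total, at most 2 b₁^k, strictly less than (a b₁)^k.
  = a ℚ.* b₁ , (0≤ab₁ , cost<) , ℚₚ.<-trans (ℚₚ.*-monoˡ-<-pos b₁ a<a₁) a₁b₁<q
  where
  instance
    b₁-pos : ℚ.Positive b₁
    b₁-pos = ℚ.positive (ℚₚ.≤-<-trans 0≤b b<b₁)
    b₁-nonNeg : ℚ.NonNegative b₁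
    b₁-nonNeg = ℚₚ.pos⇒nonNeg b₁
    D-pos : ℚ.Positive (ι D)
    D-pos = ι-pos D
    D-nonZero : ℚ.NonZero (ι D)
    D-nonZero = ℚₚ.pos⇒nonZero (ι D)
    1/D-pos : ℚ.Positive (ℚ.1/ ι D)
    1/D-pos = ℚₚ.1/pos⇒pos (ι D)
    s-pos : ℚ.Positive (b₁ ℚ.* ℚ.1/ ι D)
    s-pos = ℚₚ.pos*pos⇒pos b₁ (ℚ.1/ ι D)
  s = b₁ ℚ.* ℚ.1/ ι D

  unscale : ∀ c → c ℚ.* ℚ.1/ ι D ℚ.* ι D ≡ c
  unscale c = trans (ℚₚ.*-assoc c (ℚ.1/ ι D) (ι D))
    (trans (cong (c ℚ.*_) (ℚₚ.*-inverseˡ (ι D))) (ℚₚ.*-identityʳ c))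

  0≤ab₁ : 0ℚ ℚ.≤ a ℚ.* b₁
  0≤ab₁ = subst (ℚ._≤ a ℚ.* b₁) (ℚₚ.*-zeroˡ b₁) (ℚₚ.*-monoʳ-≤-nonNeg b₁ 0≤a)

  dist< : ∀ x y → Above (dist x y) (s ℚ.* ι (e x y))
  dist< x y = t ℚ.* ι (e x y) , (0≤te , fromℕ-upperBound (hamming x y) h<) ,
    ℚₚ.*-monoˡ-<-pos (ι (e x y)) (ℚₚ.*-monoˡ-<-pos (ℚ.1/ ι D) b<b₁)
    where
    t = b ℚ.* ℚ.1/ ι D
    instance
      e-nonZero : NonZero (e x y)
      e-nonZero = ℕ.>-nonZero (0<e x y)
      e-pos : ℚ.Positive (ι (e x y))
      e-pos = ι-pos (e x y)
      e²-pos : ℚ.Positive (ι (e x y) ^ℚ 2)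
      e²-pos = ^ℚ-pos (ι (e x y)) 2
      D²-pos : ℚ.Positive (ι D ^ℚ 2)
      D²-pos = ^ℚ-pos (ι D) 2
      D²-nonNeg : ℚ.NonNegative (ι D ^ℚ 2)
      D²-nonNeg = ℚₚ.pos⇒nonNeg (ι D ^ℚ 2)
      e-nonNeg : ℚ.NonNegative (ι (e x y))
      e-nonNeg = ι-nonNeg (e x y)
      1/D-nonNeg : ℚ.NonNegative (ℚ.1/ ι D)
      1/D-nonNeg = ℚₚ.pos⇒nonNeg (ℚ.1/ ι D)
      b-nonNeg : ℚ.NonNegative b
      b-nonNeg = ℚ.nonNegative 0≤b
      t-nonNeg : ℚ.NonNegative t
      t-nonNeg = ℚₚ.nonNeg*nonNeg⇒nonNeg b (ℚ.1/ ι D)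
    0≤te : 0ℚ ℚ.≤ t ℚ.* ι (e x y)
    0≤te = ℚₚ.nonNegative⁻¹ _ {{ℚₚ.nonNeg*nonNeg⇒nonNeg t (ι (e x y))}}
    h< : ι (hamming x y) ℚ.< (t ℚ.* ι (e x y)) ^ℚ 2
    h< = ℚₚ.*-cancelʳ-<-nonNeg (ι D ^ℚ 2) (begin-strict
      ι (hamming x y) ℚ.* ι D ^ℚ 2
        ≡⟨ trans (ι-* (hamming x y) (D ℕ.^ 2)) (cong (ι (hamming x y) ℚ.*_) (ι-^ D 2)) ⟨
      ι (hamming x y ℕ.* D ℕ.^ 2)            ≤⟨ ι-mono-≤ (e-bound x y) ⟩
      ι (k ℕ.* e x y ℕ.^ 2)
        ≡⟨ trans (ι-* k (e x y ℕ.^ 2)) (cong (ι k ℚ.*_) (ι-^ (e x y) 2)) ⟩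
      ι k ℚ.* ι (e x y) ^ℚ 2
        <⟨ ℚₚ.*-monoˡ-<-pos (ι (e x y) ^ℚ 2) (Above-fromℕ⁻ {k} k<b²) ⟩
      b ^ℚ 2 ℚ.* ι (e x y) ^ℚ 2              ≡⟨ cong (λ c → c ^ℚ 2 ℚ.* ι (e x y) ^ℚ 2) (unscale b) ⟨
      (t ℚ.* ι D) ^ℚ 2 ℚ.* ι (e x y) ^ℚ 2    ≡⟨ ^ℚ-distrib-* (t ℚ.* ι D) (ι (e x y)) 2 ⟨
      (t ℚ.* ι D ℚ.* ι (e x y)) ^ℚ 2         ≡⟨ cong (_^ℚ 2) (swapʳ t (ι D) (ι (e x y))) ⟩
      (t ℚ.* ι (e x y) ℚ.* ι D) ^ℚ 2         ≡⟨ ^ℚ-distrib-* (t ℚ.* ι (e x y)) (ι D) 2 ⟩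
      (t ℚ.* ι (e x y)) ^ℚ 2 ℚ.* ι D ^ℚ 2    ∎)
      where
      open ℚₚ.≤-Reasoning
      swapʳ : ∀ x y z → x ℚ.* y ℚ.* z ≡ x ℚ.* z ℚ.* y
      swapʳ x y z = trans (ℚₚ.*-assoc x y z)
        (trans (cong (x ℚ.*_) (ℚₚ.*-comm y z)) (sym (ℚₚ.*-assoc x z y)))

  edge≤ : ∀ (v : Vertex k × Vertex k) → let (x , y) = v in
          UpperBound (dist x y ^ k) (s ^ℚ k ℚ.* ι (e x y ℕ.^ k))
  edge≤ (x , y) {q} lt = ^-upperBound {dist x y} (dist< x y) k
    (subst (ℚ._< q) (trans (cong (s ^ℚ k ℚ.*_) (ι-^ (e x y) k))
                           (sym (^ℚ-distrib-* s (ι (e x y)) k))) lt)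

  cost< : Above (sum (map (λ (x , y) → dist x y ^ k) (cyclicEdges (tour H)))) ((a ℚ.* b₁) ^ℚ k)
  cost< = sum-upperBound (λ (x , y) → dist x y ^ k) (λ (x , y) → e x y ℕ.^ k)
                         (s ^ℚ k) edge≤ (cyclicEdges (tour H)) (begin-strict
    s ^ℚ k ℚ.* ι (sumℕ (map (λ (x , y) → e x y ℕ.^ k) (cyclicEdges (tour H))))
      ≤⟨ ℚₚ.*-monoˡ-≤-nonNeg (s ^ℚ k) {{ℚₚ.pos⇒nonNeg (s ^ℚ k) {{^ℚ-pos s k}}}} (ι-mono-≤ total) ⟩
    s ^ℚ k ℚ.* ι (2 ℕ.* D ℕ.^ k)       ≡⟨ cong (s ^ℚ k ℚ.*_) (trans (cong ι (ℕₚ.*-comm 2 (D ℕ.^ k))) (ι-* (D ℕ.^ k) 2)) ⟩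
    s ^ℚ k ℚ.* (ι (D ℕ.^ k) ℚ.* ι 2)   ≡⟨ ℚₚ.*-assoc (s ^ℚ k) (ι (D ℕ.^ k)) (ι 2) ⟨
    s ^ℚ k ℚ.* ι (D ℕ.^ k) ℚ.* ι 2     ≡⟨ cong (λ c → s ^ℚ k ℚ.* c ℚ.* ι 2) (ι-^ D k) ⟩
    s ^ℚ k ℚ.* ι D ^ℚ k ℚ.* ι 2        ≡⟨ cong (ℚ._* ι 2) (^ℚ-distrib-* s (ι D) k) ⟨
    (s ℚ.* ι D) ^ℚ k ℚ.* ι 2           ≡⟨ cong (λ c → c ^ℚ k ℚ.* ι 2) (unscale b₁) ⟩
    b₁ ^ℚ k ℚ.* ι 2                    <⟨ ℚₚ.*-monoʳ-<-pos (b₁ ^ℚ k) {{^ℚ-pos b₁ k}} (Above-fromℕ⁻ {2} 2<aᵏ) ⟩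
    b₁ ^ℚ k ℚ.* a ^ℚ k                 ≡⟨ ℚₚ.*-comm (b₁ ^ℚ k) (a ^ℚ k) ⟩
    a ^ℚ k ℚ.* b₁ ^ℚ k                 ≡⟨ ^ℚ-distrib-* a b₁ k ⟨
    (a ℚ.* b₁) ^ℚ k                    ∎)
    where
    open ℚₚ.≤-Reasoning

-- Paths and tours

-- A path is stored by its first vertex and the remaining ones.

Path : Set → Set
Path V = V × List V

module _ {V : Set} where

  verts : Path V → List V
  verts (x , xs) = x ∷ xs

  end : V → List V → V
  end x []       = x
  end x (y ∷ ys) = end y ys

  end-++ : ∀ x xs y ys → end x (xs ++ y ∷ ys) ≡ end y ys
  end-++ x []       y ys = refl
  end-++ x (z ∷ zs) y ys = end-++ z zs y ys

  -- Reversal with an accumulator. With a path `y ∷ ys` as accumulator it joins two paths at their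
  -- first vertices; with the empty list it reverses a path.
  revOnto : V → List V → List V → Path V
  revOnto x []       ys = x , ys
  revOnto x (z ∷ zs) ys = revOnto z zs (x ∷ ys)

  verts-revOnto : ∀ x xs ys → verts (revOnto x xs ys) ↭ x ∷ xs ++ ys
  verts-revOnto x []       ys = ↭-refl
  verts-revOnto x (z ∷ zs) ys =
    ↭-trans (verts-revOnto z zs (x ∷ ys)) (↭ₚ.shift x (z ∷ zs) ys)

  start-revOnto : ∀ x xs ys → proj₁ (revOnto x xs ys) ≡ end x xs
  start-revOnto x []       ys = refl
  start-revOnto x (z ∷ zs) ys = start-revOnto z zs (x ∷ ys)

  end-revOnto : ∀ x xs y ys → let (z , zs) = revOnto x xs (y ∷ ys) in
                end z zs ≡ end y ys
  end-revOnto x []       y ys = refl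
  end-revOnto x (z ∷ zs) y ys = end-revOnto z zs x (y ∷ ys)

  end-reverse : ∀ x xs → let (z , zs) = revOnto x xs [] in end z zs ≡ x
  end-reverse x []       = refl
  end-reverse x (z ∷ zs) = end-revOnto z zs x []

  concatMap-↭ : ∀ {F G : List (Path V)} → F ↭ G → concatMap verts F ↭ concatMap verts G
  concatMap-↭ _↭_.refl = ↭-refl
  concatMap-↭ (prep P F↭G) = ↭ₚ.++⁺ˡ (verts P) (concatMap-↭ F↭G)
  concatMap-↭ (swap {xs} {ys} P Q F↭G) = begin
    verts P ++ verts Q ++ concatMap verts xs   ≡⟨ Listₚ.++-assoc (verts P) (verts Q) _ ⟨
    (verts P ++ verts Q) ++ concatMap verts xs ↭⟨ ↭ₚ.++⁺ (↭ₚ.++-comm (verts P) (verts Q)) (concatMap-↭ F↭G) ⟩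
    (verts Q ++ verts P) ++ concatMap verts ys ≡⟨ Listₚ.++-assoc (verts Q) (verts P) _ ⟩
    verts Q ++ verts P ++ concatMap verts ys   ∎
    where
    open PermutationReasoning
  concatMap-↭ (_↭_.trans p q) = ↭-trans (concatMap-↭ p) (concatMap-↭ q)

module PathCost {V : Set} (c : V → V → ℕ) (c-comm : ∀ x y → c x y ≡ c y x) where

  pathCost : V → List V → ℕ
  pathCost x []       = 0
  pathCost x (y ∷ ys) = c x y ℕ.+ pathCost y ys

  cost : Path V → ℕ
  cost (x , xs) = pathCost x xs

  pathCost-++ : ∀ x xs y ys → pathCost x (xs ++ y ∷ ys) ≡
                pathCost x xs ℕ.+ c (end x xs) y ℕ.+ pathCost y ys
  pathCost-++ x []       y ys = refl
  pathCost-++ x (z ∷ zs) y ys = begin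
    c x z ℕ.+ pathCost z (zs ++ y ∷ ys)
      ≡⟨ cong (c x z ℕ.+_) (pathCost-++ z zs y ys) ⟩
    c x z ℕ.+ (pathCost z zs ℕ.+ c (end z zs) y ℕ.+ pathCost y ys)
      ≡⟨ solve 4 (λ a b d e → a :+ (b :+ d :+ e) := a :+ b :+ d :+ e) refl
           (c x z) (pathCost z zs) (c (end z zs) y) (pathCost y ys) ⟩
    c x z ℕ.+ pathCost z zs ℕ.+ c (end z zs) y ℕ.+ pathCost y ys ∎
    where
    open ≡-Reasoning
    open +-*-Solver

  -- Symmetry of `c` makes the reversed part as expensive as before; the only new edge joins the two
  -- first vertices.
  cost-revOnto : ∀ x xs y ys → cost (revOnto x xs (y ∷ ys)) ≡
                 pathCost x xs ℕ.+ c x y ℕ.+ pathCost y ys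
  cost-revOnto x []       y ys = refl
  cost-revOnto x (z ∷ zs) y ys = begin
    cost (revOnto z zs (x ∷ y ∷ ys))
      ≡⟨ cost-revOnto z zs x (y ∷ ys) ⟩
    pathCost z zs ℕ.+ c z x ℕ.+ (c x y ℕ.+ pathCost y ys)
      ≡⟨ cong (λ w → pathCost z zs ℕ.+ w ℕ.+ (c x y ℕ.+ pathCost y ys)) (c-comm z x) ⟩
    pathCost z zs ℕ.+ c x z ℕ.+ (c x y ℕ.+ pathCost y ys)
      ≡⟨ solve 4 (λ a b d e → a :+ b :+ (d :+ e) := b :+ a :+ d :+ e) refl
           (pathCost z zs) (c x z) (c x y) (pathCost y ys) ⟩
    c x z ℕ.+ pathCost z zs ℕ.+ c x y ℕ.+ pathCost y ys ∎
    where
    open ≡-Reasoning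
    open +-*-Solver

  cost-reverse : ∀ x xs → cost (revOnto x xs []) ≡ pathCost x xs
  cost-reverse x []       = refl
  cost-reverse x (z ∷ zs) = begin
    cost (revOnto z zs (x ∷ []))          ≡⟨ cost-revOnto z zs x [] ⟩
    pathCost z zs ℕ.+ c z x ℕ.+ 0         ≡⟨ ℕₚ.+-identityʳ _ ⟩
    pathCost z zs ℕ.+ c z x               ≡⟨ ℕₚ.+-comm (pathCost z zs) (c z x) ⟩
    c z x ℕ.+ pathCost z zs               ≡⟨ cong (ℕ._+ pathCost z zs) (c-comm z x) ⟩
    c x z ℕ.+ pathCost z zs               ∎
    where
    open ≡-Reasoning

  tourCost : List V → ℕ
  tourCost xs = sumℕ (map (λ (x , y) → c x y) (cyclicEdges xs))

  tourCost-∷ : ∀ x xs → tourCost (x ∷ xs) ≡ pathCost x xs ℕ.+ c (end x xs) x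
  tourCost-∷ x xs = trans (walk x xs x)
    (trans (pathCost-++ x xs x []) (ℕₚ.+-identityʳ _))
    where
    -- The closing vertex `z` is separated from the start, which changes during the induction.
    walk : ∀ x xs z → sumℕ (map (λ (x , y) → c x y) (zip (x ∷ xs) (xs ∷ʳ z))) ≡
           pathCost x (xs ∷ʳ z)
    walk x []       z = refl
    walk x (y ∷ ys) z = cong (c x y ℕ.+_) (walk y ys z)

  -- First of the two ways to close up two paths: each end is joined to the start of the other path.
  -- In `tourCost-reverse-join` the ends are joined to each other, and so are the starts.
  tourCost-join : ∀ x xs y ys → tourCost (x ∷ xs ++ y ∷ ys) ≡
    pathCost x xs ℕ.+ pathCost y ys ℕ.+ (c (end x xs) y ℕ.+ c x (end y ys))
  tourCost-join x xs y ys = begin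
    tourCost (x ∷ xs ++ y ∷ ys)                             ≡⟨ tourCost-∷ x (xs ++ y ∷ ys) ⟩
    pathCost x (xs ++ y ∷ ys) ℕ.+ c (end x (xs ++ y ∷ ys)) x
      ≡⟨ cong₂ ℕ._+_ (pathCost-++ x xs y ys)
           (trans (cong (λ z → c z x) (end-++ x xs y ys)) (c-comm (end y ys) x)) ⟩
    pathCost x xs ℕ.+ c (end x xs) y ℕ.+ pathCost y ys ℕ.+ c x (end y ys)
      ≡⟨ solve 4 (λ a b d e → a :+ b :+ d :+ e := a :+ d :+ (b :+ e)) refl
           (pathCost x xs) (c (end x xs) y) (pathCost y ys) (c x (end y ys)) ⟩
    pathCost x xs ℕ.+ pathCost y ys ℕ.+ (c (end x xs) y ℕ.+ c x (end y ys)) ∎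
    where
    open ≡-Reasoning
    open +-*-Solver

  tourCost-reverse-join : ∀ x xs y ys →
    tourCost (x ∷ xs ++ verts (revOnto y ys [])) ≡
    pathCost x xs ℕ.+ pathCost y ys ℕ.+ (c (end x xs) (end y ys) ℕ.+ c x y)
  tourCost-reverse-join x xs y ys
    rewrite tourCost-join x xs (proj₁ (revOnto y ys [])) (proj₂ (revOnto y ys []))
          | cost-reverse y ys | end-reverse y ys | start-revOnto y ys [] = refl

  forestCost : List (Path V) → ℕ
  forestCost F = sumℕ (map cost F)

  -- Greedy merging: as long as more than `N` paths are left, two with close first vertices are
  -- joined by an edge of cost at most `B`. Each merge removes one path, so the bound `m` on the
  -- number of paths serves as fuel and also bounds the number of merges. As 2 ≤ N, at least two
  -- paths survive.
  merge : ∀ N B → 2 ℕ.≤ N →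
    (∀ F → N ℕ.< length F → ∃[ P ] ∃[ Q ] ∃[ R ]
      (F ↭ P ∷ Q ∷ R × c (proj₁ P) (proj₁ Q) ℕ.≤ B)) →
    ∀ m F → length F ℕ.≤ m → 2 ℕ.≤ length F →
    ∃[ G ] (concatMap verts G ↭ concatMap verts F ×
            2 ℕ.≤ length G × length G ℕ.≤ N ×
            forestCost G ℕ.≤ forestCost F ℕ.+ m ℕ.* B)
  merge N B 2≤N close zero F |F|≤0 2≤|F| with () ← ℕₚ.≤-trans 2≤|F| |F|≤0
  merge N B 2≤N close (suc m) F |F|≤1+m 2≤|F| with length F ℕₚ.≤? N
  ... | yes |F|≤N = F , ↭-refl , 2≤|F| , |F|≤N , ℕₚ.m≤m+n _ _
  ... | no  |F|≰N with close F (ℕₚ.≰⇒> |F|≰N)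
  ... | (x , xs) , (y , ys) , R , F↭ , c≤B =
    let (G , G↭ , 2≤|G| , |G|≤N , cost≤) = merge N B 2≤N close m F′
          (ℕ.s≤s⁻¹ (subst (ℕ._≤ suc m) |F| |F|≤1+m))
          (ℕₚ.≤-trans 2≤N (ℕ.s≤s⁻¹ (subst (N ℕ.<_) |F| (ℕₚ.≰⇒> |F|≰N))))
    in G , ↭-trans G↭ F′↭F , 2≤|G| , |G|≤N , ℕₚ.≤-trans cost≤ bound
    where
    F′ = revOnto x xs (y ∷ ys) ∷ R
    |F| : length F ≡ suc (length F′)
    |F| = ↭ₚ.↭-length F↭
    F′↭F : concatMap verts F′ ↭ concatMap verts F
    F′↭F = begin
      verts (revOnto x xs (y ∷ ys)) ++ concatMap verts R
        ↭⟨ ↭ₚ.++⁺ʳ (concatMap verts R) (verts-revOnto x xs (y ∷ ys)) ⟩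
      (x ∷ xs ++ y ∷ ys) ++ concatMap verts R  ≡⟨ Listₚ.++-assoc (x ∷ xs) (y ∷ ys) _ ⟩
      (x ∷ xs) ++ (y ∷ ys) ++ concatMap verts R ↭⟨ concatMap-↭ F↭ ⟨
      concatMap verts F                         ∎
      where
      open PermutationReasoning
    bound : cost (revOnto x xs (y ∷ ys)) ℕ.+ forestCost R ℕ.+ m ℕ.* B ℕ.≤
            forestCost F ℕ.+ (B ℕ.+ m ℕ.* B)
    bound = begin
      cost (revOnto x xs (y ∷ ys)) ℕ.+ forestCost R ℕ.+ m ℕ.* B
        ≡⟨ cong (λ w → w ℕ.+ forestCost R ℕ.+ m ℕ.* B) (cost-revOnto x xs y ys) ⟩
      pathCost x xs ℕ.+ c x y ℕ.+ pathCost y ys ℕ.+ forestCost R ℕ.+ m ℕ.* B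
        ≡⟨ solve 5 (λ a b d e f → a :+ b :+ d :+ e :+ f := a :+ (d :+ e) :+ (b :+ f)) refl
             (pathCost x xs) (c x y) (pathCost y ys) (forestCost R) (m ℕ.* B) ⟩
      pathCost x xs ℕ.+ (pathCost y ys ℕ.+ forestCost R) ℕ.+ (c x y ℕ.+ m ℕ.* B)
        ≡⟨ cong (ℕ._+ (c x y ℕ.+ m ℕ.* B)) (sum-↭ (↭ₚ.map⁺ cost F↭)) ⟨
      forestCost F ℕ.+ (c x y ℕ.+ m ℕ.* B)
        ≤⟨ ℕₚ.+-monoʳ-≤ (forestCost F) (ℕₚ.+-monoˡ-≤ (m ℕ.* B) c≤B) ⟩
      forestCost F ℕ.+ (B ℕ.+ m ℕ.* B) ∎
      where
      open ℕₚ.≤-Reasoning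
      open +-*-Solver

-- Hamming distances

hamming-comm : ∀ {k} (x y : Vertex k) → hamming x y ≡ hamming y x
hamming-comm []       []       = refl
hamming-comm (a ∷ x) (b ∷ y) =
  cong₂ ℕ._+_ (cong (ℕ._^ 2) (ℕₚ.∣-∣-comm (toℕ a) (toℕ b))) (hamming-comm x y)

hamming≤ : ∀ {k} (x y : Vertex k) → hamming x y ℕ.≤ k
hamming≤ []             []             = z≤n
hamming≤ (zero ∷ x)     (zero ∷ y)     = ℕₚ.m≤n⇒m≤1+n (hamming≤ x y)
hamming≤ (zero ∷ x)     (suc zero ∷ y) = s≤s (hamming≤ x y)
hamming≤ (suc zero ∷ x) (zero ∷ y)     = s≤s (hamming≤ x y)
hamming≤ (suc zero ∷ x) (suc zero ∷ y) = ℕₚ.m≤n⇒m≤1+n (hamming≤ x y)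

antipode-unique : ∀ {k} (x y z : Vertex k) → hamming x y ≡ k → hamming x z ≡ k → y ≡ z
antipode-unique [] [] [] _ _ = refl
antipode-unique (zero ∷ x) (suc zero ∷ y) (suc zero ∷ z) xy xz =
  cong (suc zero ∷_) (antipode-unique x y z (ℕₚ.suc-injective xy) (ℕₚ.suc-injective xz))
antipode-unique (suc zero ∷ x) (zero ∷ y) (zero ∷ z) xy xz =
  cong (zero ∷_) (antipode-unique x y z (ℕₚ.suc-injective xy) (ℕₚ.suc-injective xz))
-- If the first coordinates agree, the remaining `k` coordinates would have to contribute `suc k`.
antipode-unique (zero ∷ x) (zero ∷ y) _ xy _ =
  contradiction (subst (ℕ._≤ _) xy (hamming≤ x y)) ℕₚ.1+n≰n
antipode-unique (suc zero ∷ x) (suc zero ∷ y) _ xy _ =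
  contradiction (subst (ℕ._≤ _) xy (hamming≤ x y)) ℕₚ.1+n≰n
antipode-unique (zero ∷ x) (suc zero ∷ _) (zero ∷ z) _ xz =
  contradiction (subst (ℕ._≤ _) xz (hamming≤ x z)) ℕₚ.1+n≰n
antipode-unique (suc zero ∷ x) (zero ∷ _) (suc zero ∷ z) _ xz =
  contradiction (subst (ℕ._≤ _) xz (hamming≤ x z)) ℕₚ.1+n≰n

-- A coordinate takes only two values, so at most two of the three pairs differ in it.
perimeter≤ : ∀ {k} (x y z : Vertex k) →
             hamming x y ℕ.+ hamming x z ℕ.+ hamming y z ℕ.≤ 2 ℕ.* k
perimeter≤ [] [] [] = z≤n
perimeter≤ {suc k} (a ∷ x) (b ∷ y) (d ∷ z) = begin
  (δ a b ℕ.+ hamming x y) ℕ.+ (δ a d ℕ.+ hamming x z) ℕ.+ (δ b d ℕ.+ hamming y z)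
    ≡⟨ solve 6 (λ p q r u v w → (p :+ u) :+ (q :+ v) :+ (r :+ w) := (p :+ q :+ r) :+ (u :+ v :+ w)) refl
         (δ a b) (δ a d) (δ b d) (hamming x y) (hamming x z) (hamming y z) ⟩
  (δ a b ℕ.+ δ a d ℕ.+ δ b d) ℕ.+ (hamming x y ℕ.+ hamming x z ℕ.+ hamming y z)
    ≤⟨ ℕₚ.+-mono-≤ (bit a b d) (perimeter≤ x y z) ⟩
  2 ℕ.+ 2 ℕ.* k  ≡⟨ ℕₚ.*-suc 2 k ⟨
  2 ℕ.* suc k    ∎
  where
  open ℕₚ.≤-Reasoning
  open +-*-Solver
  δ : Fin 2 → Fin 2 → ℕ
  δ a b = ℕ.∣ toℕ a - toℕ b ∣ ℕ.^ 2
  bit : ∀ a b d → δ a b ℕ.+ δ a d ℕ.+ δ b d ℕ.≤ 2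
  bit zero       zero       zero       = z≤n
  bit zero       zero       (suc zero) = ℕₚ.≤-refl
  bit zero       (suc zero) zero       = ℕₚ.≤-refl
  bit zero       (suc zero) (suc zero) = ℕₚ.≤-refl
  bit (suc zero) zero       zero       = ℕₚ.≤-refl
  bit (suc zero) zero       (suc zero) = ℕₚ.≤-refl
  bit (suc zero) (suc zero) zero       = ℕₚ.≤-refl
  bit (suc zero) (suc zero) (suc zero) = z≤n

split : ∀ {A : Set} (f : A → Fin 2) (L : List A) → ∃[ L₀ ] ∃[ L₁ ]
        (L ↭ L₀ ++ L₁ × All (λ a → f a ≡ zero) L₀ × All (λ a → f a ≡ suc zero) L₁)
split f [] = [] , [] , ↭-refl , [] , []
split f (a ∷ L) with split f L | f a in fa
... | L₀ , L₁ , L↭ , all₀ , all₁ | zero     = a ∷ L₀ , L₁ , prep a L↭ , fa ∷ all₀ , all₁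
... | L₀ , L₁ , L↭ , all₀ , all₁ | suc zero =
  L₀ , a ∷ L₁ , ↭-trans (prep a L↭) (↭-sym (↭ₚ.shift a L₀ L₁)) , all₀ , fa ∷ all₁

-- Pigeonhole on one bit. The rest `R` is returned too, since the chosen entries must later be put
-- back into a permutation of the whole list.
halve : ∀ {A : Set} (f : A → Fin 2) {m} (L : List A) → 2 ℕ.* m ℕ.< length L →
        ∃[ b ] ∃[ M ] ∃[ R ] (L ↭ M ++ R × m ℕ.< length M × All (λ a → f a ≡ b) M)
halve f {m} L 2m<|L| with split f L
... | L₀ , L₁ , L↭ , all₀ , all₁ with m ℕₚ.<? length L₀
...   | yes m<|L₀| = zero , L₀ , L₁ , L↭ , m<|L₀| , all₀
...   | no  m≮|L₀| = suc zero , L₁ , L₀ , ↭-trans L↭ (↭ₚ.++-comm L₀ L₁) , m<|L₁| , all₁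
  where
  open ℕₚ.≤-Reasoning
  m<|L₁| : m ℕ.< length L₁
  m<|L₁| = ℕₚ.+-cancelˡ-< m m (length L₁) (begin-strict
    m ℕ.+ m                       ≡⟨ cong (m ℕ.+_) (ℕₚ.+-identityʳ m) ⟨
    2 ℕ.* m                       <⟨ 2m<|L| ⟩
    length L                      ≡⟨ ↭ₚ.↭-length L↭ ⟩
    length (L₀ ++ L₁)             ≡⟨ Listₚ.length-++ L₀ ⟩
    length L₀ ℕ.+ length L₁       ≤⟨ ℕₚ.+-monoˡ-≤ (length L₁) (ℕₚ.≮⇒≥ m≮|L₀|) ⟩
    m ℕ.+ length L₁               ∎)

hamming-tail : ∀ {k} (x y : Vertex (suc k)) → Vec.head x ≡ Vec.head y →
               hamming x y ≡ hamming (Vec.tail x) (Vec.tail y)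
hamming-tail (a ∷ x) (.a ∷ y) refl =
  cong (λ n → n ℕ.^ 2 ℕ.+ hamming x y) (ℕₚ.∣n-n∣≡0 (toℕ a))

one-of-three : ∀ a b d {m} → a ℕ.+ b ℕ.+ d ℕ.≤ m →
               3 ℕ.* a ℕ.≤ m ⊎ 3 ℕ.* b ℕ.≤ m ⊎ 3 ℕ.* d ℕ.≤ m
one-of-three a b d {m} sum≤ with 3 ℕ.* a ℕₚ.≤? m | 3 ℕ.* b ℕₚ.≤? m | 3 ℕ.* d ℕₚ.≤? m
... | yes a≤ | _      | _      = inj₁ a≤
... | no _   | yes b≤ | _      = inj₂ (inj₁ b≤)
... | no _   | no _   | yes d≤ = inj₂ (inj₂ d≤)
... | no a≰  | no b≰  | no d≰  = contradiction (ℕₚ.*-monoʳ-≤ 3 sum≤) (ℕₚ.<⇒≱ (begin-strict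
  3 ℕ.* m                              ≡⟨ solve 1 (λ m → con 3 :* m := m :+ m :+ m) refl m ⟩
  m ℕ.+ m ℕ.+ m                        <⟨ ℕₚ.+-mono-< (ℕₚ.+-mono-< (ℕₚ.≰⇒> a≰) (ℕₚ.≰⇒> b≰)) (ℕₚ.≰⇒> d≰) ⟩
  3 ℕ.* a ℕ.+ 3 ℕ.* b ℕ.+ 3 ℕ.* d      ≡⟨ solve 3 (λ a b d → con 3 :* a :+ con 3 :* b :+ con 3 :* d := con 3 :* (a :+ b :+ d)) refl a b d ⟩
  3 ℕ.* (a ℕ.+ b ℕ.+ d)                ∎))
  where
  open ℕₚ.≤-Reasoning
  open +-*-Solver

m≤n⇒m+0≤n : ∀ {m n} → m ℕ.≤ n → m ℕ.+ 0 ℕ.≤ n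
m≤n⇒m+0≤n {m} {n} = subst (ℕ._≤ n) (sym (ℕₚ.+-identityʳ m))

-- Three of the points agree in the first j coordinates, and the perimeter of
-- their triangle is at most 2(k − j).

close-pair : ∀ {A : Set} {k} j (f : A → Vertex k) → j ℕ.≤ k → ∀ L → 2 ℕ.^ suc j ℕ.< length L →
             ∃[ a ] ∃[ b ] ∃[ R ] (L ↭ a ∷ b ∷ R ×
               3 ℕ.* hamming (f a) (f b) ℕ.+ 2 ℕ.* j ℕ.≤ 2 ℕ.* k)
close-pair zero f _ (a ∷ b ∷ d ∷ R) _ 
  with one-of-three (hamming (f a) (f b)) (hamming (f a) (f d)) (hamming (f b) (f d))
         (perimeter≤ (f a) (f b) (f d))
... | inj₁ ab≤        = a , b , d ∷ R , ↭-refl , m≤n⇒m+0≤n ab≤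
... | inj₂ (inj₁ ad≤) = a , d , b ∷ R , prep a (swap b d ↭-refl) ,
                        m≤n⇒m+0≤n ad≤
... | inj₂ (inj₂ bd≤) = b , d , a ∷ R , ↭-sym (↭ₚ.shift a (b ∷ d ∷ []) R) ,
                        m≤n⇒m+0≤n bd≤
close-pair zero f _ (_ ∷ []) (s≤s ())
close-pair zero f _ (_ ∷ _ ∷ []) (s≤s (s≤s ()))
-- Fixing the more frequent first bit costs a factor 2 in the number of entries. On the selected
-- entries it does not contribute to distances, and `j` and `k` drop together. Composing `f` with
-- `tail` leaves the entries themselves, which will be paths, untouched.
close-pair {k = suc k} (suc j) f (s≤s j≤k) L lt
  with halve (Vec.head ∘ f) L lt
... | _ , M , N , L↭ , M> , same
  with close-pair j (Vec.tail ∘ f) j≤k M M>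
... | a , b , R , M↭ , close with ↭ₚ.All-resp-↭ M↭ same
... | fa ∷ fb ∷ _ = a , b , R ++ N , ↭-trans L↭ (↭ₚ.++⁺ʳ N M↭) , (begin
  3 ℕ.* hamming (f a) (f b) ℕ.+ 2 ℕ.* suc j
    ≡⟨ cong₂ (λ h l → 3 ℕ.* h ℕ.+ l) (hamming-tail (f a) (f b) (trans fa (sym fb))) (ℕₚ.*-suc 2 j) ⟩
  3 ℕ.* h ℕ.+ (2 ℕ.+ 2 ℕ.* j)
    ≡⟨ solve 2 (λ u v → u :+ (con 2 :+ v) := con 2 :+ (u :+ v)) refl (3 ℕ.* h) (2 ℕ.* j) ⟩
  2 ℕ.+ (3 ℕ.* h ℕ.+ 2 ℕ.* j)   ≤⟨ ℕₚ.+-monoʳ-≤ 2 close ⟩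
  2 ℕ.+ 2 ℕ.* k                 ≡⟨ ℕₚ.*-suc 2 k ⟨
  2 ℕ.* suc k                   ∎)
  where
  open ℕₚ.≤-Reasoning
  open +-*-Solver
  h = hamming (Vec.tail (f a)) (Vec.tail (f b))

Unique-resp-↭ : ∀ {A : Set} {xs ys : List A} → xs ↭ ys → Unique xs → Unique ys
Unique-resp-↭ {A} xs↭ys = ↭ₛₚ.Unique-resp-↭ (setoid A) (↭⇒↭ₛ xs↭ys)

Unique-++ˡ : ∀ {A : Set} (xs : List A) {ys} → Unique (xs ++ ys) → Unique xs
Unique-++ˡ []       _          = []
Unique-++ˡ (x ∷ xs) (x∉ ∷ uni) = Allₚ.++⁻ˡ xs x∉ ∷ Unique-++ˡ xs uni

-- Otherwise more than 2^k vertices of the (k + 1)-cube share their first bit; their tails are still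
-- distinct and contradict the bound in dimension k.
Unique⇒length≤2^ : ∀ {k} (X : List (Vertex k)) → Unique X → length X ℕ.≤ 2 ℕ.^ k
Unique⇒length≤2^ {zero} [] _ = z≤n
Unique⇒length≤2^ {zero} (_ ∷ []) _ = ℕₚ.≤-refl
Unique⇒length≤2^ {zero} ([] ∷ [] ∷ _) ((x≢x ∷ _) ∷ _) = contradiction refl x≢x
Unique⇒length≤2^ {suc k} X uni with length X ℕₚ.≤? 2 ℕ.* 2 ℕ.^ k
... | yes X≤ = X≤
... | no  X≰ with halve Vec.head X (ℕₚ.≰⇒> X≰)
... | b , M , R , X↭ , M> , same = contradiction
  (subst (ℕ._≤ 2 ℕ.^ k) (Listₚ.length-map Vec.tail M)
    (Unique⇒length≤2^ (map Vec.tail M) (tails same (Unique-++ˡ M (Unique-resp-↭ X↭ uni)))))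
  (ℕₚ.<⇒≱ M>)
  where
  tails : ∀ {M : List (Vertex (suc k))} → All (λ x → Vec.head x ≡ b) M → Unique M →
          Unique (map Vec.tail M)
  tails [] [] = []
  tails {(_ ∷ x) ∷ M} (refl ∷ same) (x∉ ∷ uni) = fresh same x∉ ∷ tails same uni
    where
    fresh : ∀ {M : List (Vertex (suc k))} → All (λ y → Vec.head y ≡ b) M →
            All (λ y → ¬ (b ∷ x) ≡ y) M → All (λ y → ¬ x ≡ y) (map Vec.tail M)
    fresh [] [] = []
    fresh {(_ ∷ y) ∷ M} (refl ∷ same) (x≢y ∷ x∉) = (λ eq → x≢y (cong (_ ∷_) eq)) ∷ fresh same x∉

-- Rounded edge costs in the cube

-- Used to round square roots up. Minimality turns every admissible value into an upper bound.
least : (P : ℕ → Set) → (∀ n → Dec (P n)) → ∀ n → P n →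
        ∃[ m ] (P m × (∀ j → P j → m ℕ.≤ j))
least P P? zero p = 0 , p , λ _ _ → z≤n
least P P? (suc n) p with P? 0
... | yes p₀ = 0 , p₀ , λ _ _ → z≤n
... | no ¬p₀ with least (P ∘ suc) (P? ∘ suc) n p
...   | m , pm , m≤ = suc m , pm , λ
        { zero p₀ → contradiction p₀ ¬p₀ ; (suc j) pj → s≤s (m≤ j pj) }

*-distribʳ-^ : ∀ m n o → (m ℕ.* n) ℕ.^ o ≡ m ℕ.^ o ℕ.* n ℕ.^ o
*-distribʳ-^ m n zero    = refl
*-distribʳ-^ m n (suc o) = trans (cong (m ℕ.* n ℕ.*_) (*-distribʳ-^ m n o))
  (solve 4 (λ a b c d → a :* b :* (c :* d) := a :* c :* (b :* d)) refl m n (m ℕ.^ o) (n ℕ.^ o))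
  where
  open +-*-Solver

-- Bernoulli's inequality in homogeneous form. The induction multiplies by a + b and drops the term
-- quadratic in b.
bernoulli : ∀ a b n → a ℕ.^ suc n ℕ.+ suc n ℕ.* b ℕ.* a ℕ.^ n ℕ.≤ (a ℕ.+ b) ℕ.^ suc n
bernoulli a b zero    = ℕₚ.≤-reflexive
  (solve 2 (λ a b → a :* con 1 :+ con 1 :* b :* con 1 := (a :+ b) :* con 1) refl a b)
  where
  open +-*-Solver
bernoulli a b (suc n) = begin
  a ℕ.* (a ℕ.* p) ℕ.+ suc (suc n) ℕ.* b ℕ.* (a ℕ.* p)
    ≤⟨ ℕₚ.m≤m+n _ _ ⟩
  a ℕ.* (a ℕ.* p) ℕ.+ suc (suc n) ℕ.* b ℕ.* (a ℕ.* p) ℕ.+ b ℕ.* (suc n ℕ.* b ℕ.* p)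
    ≡⟨ solve 4 (λ a b p m → a :* (a :* p) :+ (con 1 :+ m) :* b :* (a :* p) :+ b :* (m :* b :* p)
                          := (a :+ b) :* (a :* p :+ m :* b :* p)) refl a b p (suc n) ⟩
  (a ℕ.+ b) ℕ.* (a ℕ.* p ℕ.+ suc n ℕ.* b ℕ.* p)
    ≤⟨ ℕₚ.*-monoʳ-≤ (a ℕ.+ b) (bernoulli a b n) ⟩
  (a ℕ.+ b) ℕ.* (a ℕ.+ b) ℕ.^ suc n ∎
  where
  open ℕₚ.≤-Reasoning
  open +-*-Solver
  p = a ℕ.^ n

-- Each further factor is at most as large on the left as on the right, so one exponent `n₀`
-- suffices.
geometric : ∀ {C a b n₀} → a ℕ.≤ b → C ℕ.* a ℕ.^ n₀ ℕ.≤ b ℕ.^ n₀ →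
            ∀ n → n₀ ℕ.≤ n → C ℕ.* a ℕ.^ n ℕ.≤ b ℕ.^ n
geometric {C} {a} {b} {n₀} a≤b base n n₀≤n = begin
  C ℕ.* a ℕ.^ n                    ≡⟨ cong (λ n → C ℕ.* a ℕ.^ n) (ℕₚ.m+[n∸m]≡n n₀≤n) ⟨
  C ℕ.* a ℕ.^ (n₀ ℕ.+ d)           ≡⟨ cong (C ℕ.*_) (ℕₚ.^-distribˡ-+-* a n₀ d) ⟩
  C ℕ.* (a ℕ.^ n₀ ℕ.* a ℕ.^ d)     ≡⟨ ℕₚ.*-assoc C (a ℕ.^ n₀) (a ℕ.^ d) ⟨
  C ℕ.* a ℕ.^ n₀ ℕ.* a ℕ.^ d       ≤⟨ ℕₚ.*-mono-≤ base (ℕₚ.^-monoˡ-≤ d a≤b) ⟩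
  b ℕ.^ n₀ ℕ.* b ℕ.^ d             ≡⟨ ℕₚ.^-distribˡ-+-* b n₀ d ⟨
  b ℕ.^ (n₀ ℕ.+ d)                 ≡⟨ cong (b ℕ.^_) (ℕₚ.m+[n∸m]≡n n₀≤n) ⟩
  b ℕ.^ n                          ∎
  where
  open ℕₚ.≤-Reasoning
  d = n ℕ.∸ n₀

-- The exponent is cut into q blocks of six. In each block 2^a r^6 is at most d/b times b^6, and the
-- q gains (d/b)^q together absorb `C`. The `s` left-over factors only use r ≤ b.
tier-power : ∀ C a {b d r} q s → 2 ℕ.^ a ℕ.* r ℕ.^ 6 ℕ.≤ d ℕ.* b ℕ.^ 5 → r ℕ.≤ b →
             C ℕ.* d ℕ.^ q ℕ.≤ b ℕ.^ q →
             C ℕ.* (2 ℕ.^ (a ℕ.* q) ℕ.* r ℕ.^ (s ℕ.+ 6 ℕ.* q)) ℕ.≤ b ℕ.^ (s ℕ.+ 6 ℕ.* q)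
tier-power C a {b} {d} {r} q s ar≤ r≤b Cd≤b = begin
  C ℕ.* (2 ℕ.^ (a ℕ.* q) ℕ.* r ℕ.^ (s ℕ.+ 6 ℕ.* q))
    ≡⟨ cong₂ (λ u v → C ℕ.* (u ℕ.* v)) (sym (ℕₚ.^-*-assoc 2 a q))
         (trans (ℕₚ.^-distribˡ-+-* r s (6 ℕ.* q)) (cong (r ℕ.^ s ℕ.*_) (sym (ℕₚ.^-*-assoc r 6 q)))) ⟩
  C ℕ.* ((2 ℕ.^ a) ℕ.^ q ℕ.* (r ℕ.^ s ℕ.* (r ℕ.^ 6) ℕ.^ q))
    ≡⟨ cong (C ℕ.*_) (swap₃ ((2 ℕ.^ a) ℕ.^ q) (r ℕ.^ s) ((r ℕ.^ 6) ℕ.^ q)) ⟩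
  C ℕ.* (r ℕ.^ s ℕ.* ((2 ℕ.^ a) ℕ.^ q ℕ.* (r ℕ.^ 6) ℕ.^ q))
    ≡⟨ cong (λ u → C ℕ.* (r ℕ.^ s ℕ.* u)) (*-distribʳ-^ (2 ℕ.^ a) (r ℕ.^ 6) q) ⟨
  C ℕ.* (r ℕ.^ s ℕ.* (2 ℕ.^ a ℕ.* r ℕ.^ 6) ℕ.^ q)
    ≤⟨ ℕₚ.*-monoʳ-≤ C (ℕₚ.*-mono-≤ (ℕₚ.^-monoˡ-≤ s r≤b) (ℕₚ.^-monoˡ-≤ q ar≤)) ⟩
  C ℕ.* (b ℕ.^ s ℕ.* (d ℕ.* b ℕ.^ 5) ℕ.^ q)
    ≡⟨ cong (λ u → C ℕ.* (b ℕ.^ s ℕ.* u)) (*-distribʳ-^ d (b ℕ.^ 5) q) ⟩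
  C ℕ.* (b ℕ.^ s ℕ.* (d ℕ.^ q ℕ.* (b ℕ.^ 5) ℕ.^ q))
    ≡⟨ regroup C (b ℕ.^ s) (d ℕ.^ q) ((b ℕ.^ 5) ℕ.^ q) ⟩
  b ℕ.^ s ℕ.* (C ℕ.* d ℕ.^ q ℕ.* (b ℕ.^ 5) ℕ.^ q)
    ≤⟨ ℕₚ.*-monoʳ-≤ (b ℕ.^ s) (ℕₚ.*-monoˡ-≤ ((b ℕ.^ 5) ℕ.^ q) Cd≤b) ⟩
  b ℕ.^ s ℕ.* (b ℕ.^ q ℕ.* (b ℕ.^ 5) ℕ.^ q)
    ≡⟨ cong (b ℕ.^ s ℕ.*_) (*-distribʳ-^ b (b ℕ.^ 5) q) ⟨
  b ℕ.^ s ℕ.* (b ℕ.^ 6) ℕ.^ q        ≡⟨ cong (b ℕ.^ s ℕ.*_) (ℕₚ.^-*-assoc b 6 q) ⟩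
  b ℕ.^ s ℕ.* b ℕ.^ (6 ℕ.* q)        ≡⟨ ℕₚ.^-distribˡ-+-* b s (6 ℕ.* q) ⟨
  b ℕ.^ (s ℕ.+ 6 ℕ.* q)              ∎
  where
  open ℕₚ.≤-Reasoning
  open +-*-Solver
  swap₃ : ∀ u v w → u ℕ.* (v ℕ.* w) ≡ v ℕ.* (u ℕ.* w)
  swap₃ = solve 3 (λ u v w → u :* (v :* w) := v :* (u :* w)) refl
  regroup : ∀ u v w z → u ℕ.* (v ℕ.* (w ℕ.* z)) ≡ v ℕ.* (u ℕ.* w ℕ.* z)
  regroup = solve 4 (λ u v w z → u :* (v :* (w :* z)) := v :* (u :* w :* z)) refl

-- Compared with `tier-power`, rounding q up to `suc q` and doubling the number of paths give an
-- extra factor 2 · 2^a, which is absorbed by `C` together with `K`. The factor `w` is common to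
-- both sides.
stage-power : ∀ K C a {b d r} w q s n → n ≡ s ℕ.+ 6 ℕ.* q → K ℕ.* 2 ℕ.* 2 ℕ.^ a ℕ.≤ C →
  2 ℕ.^ a ℕ.* r ℕ.^ 6 ℕ.≤ d ℕ.* b ℕ.^ 5 → r ℕ.≤ b → C ℕ.* d ℕ.^ q ℕ.≤ b ℕ.^ q →
  K ℕ.* (2 ℕ.^ suc (a ℕ.* suc q) ℕ.* (w ℕ.* r) ℕ.^ n) ℕ.≤ (w ℕ.* b) ℕ.^ n
stage-power K C a {b} {d} {r} w q s n refl Ku≤C ar≤ r≤b Cd≤b = begin
  K ℕ.* (2 ℕ.* 2 ℕ.^ (a ℕ.* suc q) ℕ.* (w ℕ.* r) ℕ.^ n)
    ≡⟨ cong₂ (λ u v → K ℕ.* (2 ℕ.* u ℕ.* v))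
         (trans (cong (2 ℕ.^_) (ℕₚ.*-suc a q)) (ℕₚ.^-distribˡ-+-* 2 a (a ℕ.* q)))
         (*-distribʳ-^ w r n) ⟩
  K ℕ.* (2 ℕ.* (2 ℕ.^ a ℕ.* v) ℕ.* (w ℕ.^ n ℕ.* r ℕ.^ n))
    ≡⟨ solve 5 (λ K u v w z → K :* (con 2 :* (u :* v) :* (w :* z)) := w :* (K :* con 2 :* u :* (v :* z)))
         refl K (2 ℕ.^ a) v (w ℕ.^ n) (r ℕ.^ n) ⟩
  w ℕ.^ n ℕ.* (K ℕ.* 2 ℕ.* 2 ℕ.^ a ℕ.* (v ℕ.* r ℕ.^ n))
    ≤⟨ ℕₚ.*-monoʳ-≤ (w ℕ.^ n) (ℕₚ.*-monoˡ-≤ (v ℕ.* r ℕ.^ n) Ku≤C) ⟩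
  w ℕ.^ n ℕ.* (C ℕ.* (v ℕ.* r ℕ.^ n))
    ≤⟨ ℕₚ.*-monoʳ-≤ (w ℕ.^ n) (tier-power C a q s ar≤ r≤b Cd≤b) ⟩
  w ℕ.^ n ℕ.* b ℕ.^ n        ≡⟨ *-distribʳ-^ w b n ⟨
  (w ℕ.* b) ℕ.^ n            ∎
  where
  open ℕₚ.≤-Reasoning
  open +-*-Solver
  v = 2 ℕ.^ (a ℕ.* q)

-- ρ i / 20 is an upper bound of √(6 − i) / 3 with 2^{(i+1)/6} ρ i / 20 < 1.

ρ : Fin 6 → ℕ
ρ = Vec.lookup (17 ∷ 15 ∷ 14 ∷ 12 ∷ 10 ∷ 8 ∷ [])

ρ-dist : ∀ i → 400 ℕ.* (6 ℕ.∸ toℕ i) ℕ.≤ 9 ℕ.* ρ i ℕ.^ 2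
ρ-dist = from-yes (Finₚ.all? λ i → 400 ℕ.* (6 ℕ.∸ toℕ i) ℕₚ.≤? 9 ℕ.* ρ i ℕ.^ 2)

-- After division by 20^6, six coordinates gain a factor 19/20 over the growth in the number of
-- paths.
ρ-power : ∀ i → 2 ℕ.^ suc (toℕ i) ℕ.* ρ i ℕ.^ 6 ℕ.≤ 19 ℕ.* 20 ℕ.^ 5
ρ-power = from-yes (Finₚ.all? λ i → 2 ℕ.^ suc (toℕ i) ℕ.* ρ i ℕ.^ 6 ℕₚ.≤? 19 ℕ.* 20 ℕ.^ 5)

0<ρ≤20 : ∀ i → 0 ℕ.< ρ i × ρ i ℕ.≤ 20
0<ρ≤20 = from-yes (Finₚ.all? λ i → (0 ℕₚ.<? ρ i) ×-dec (ρ i ℕₚ.≤? 20))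

-- 2304 = 18·2·2⁶

36·2^≤ : ∀ (i : Fin 6) → 18 ℕ.* 2 ℕ.* 2 ℕ.^ suc (toℕ i) ℕ.≤ 2304
36·2^≤ = from-yes (Finₚ.all? λ (i : Fin 6) → 18 ℕ.* 2 ℕ.* 2 ℕ.^ suc (toℕ i) ℕₚ.≤? 2304)

-- The exponent 160 is k/6 at the threshold k = 960.
2304·19^160≤20^160 : 2304 ℕ.* 19 ℕ.^ 160 ℕ.≤ 20 ℕ.^ 160
2304·19^160≤20^160 = from-yes (2304 ℕ.* 19 ℕ.^ 160 ℕₚ.≤? 20 ℕ.^ 160)

module Weights (k′ : ℕ) where

  -- In units of √k/D, an antipodal pair has length `D`, so `M` stands for its cost k^(k/2). The
  -- factor 20 of `D` makes the bounds ρ i / 20 integral, and the factor 2k does so for 1 - 1/(2k).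
  k D M : ℕ
  k = suc k′
  D = k ℕ.* 2 ℕ.* 20
  M = D ℕ.^ k

  private
    Root : ℕ → ℕ → Set
    Root h e = 0 ℕ.< e × h ℕ.* D ℕ.^ 2 ℕ.≤ k ℕ.* e ℕ.^ 2

    root? : ∀ h e → Dec (Root h e)
    root? h e = (0 ℕₚ.<? e) ×-dec (h ℕ.* D ℕ.^ 2 ℕₚ.≤? k ℕ.* e ℕ.^ 2)

    Root-D : ∀ (x y : Vertex k) → Root (hamming x y) D
    Root-D x y = s≤s z≤n , ℕₚ.*-monoˡ-≤ (D ℕ.^ 2) (hamming≤ x y)

    leastRoot : ∀ (x y : Vertex k) → _
    leastRoot x y = least (Root (hamming x y)) (root? (hamming x y)) D (Root-D x y)

  -- The distance of x and y, rounded up to a multiple of √k/D.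

  edge : Vertex k → Vertex k → ℕ
  edge x y = proj₁ (leastRoot x y)

  0<edge : ∀ x y → 0 ℕ.< edge x y
  0<edge x y = proj₁ (proj₁ (proj₂ (leastRoot x y)))

  edge-bound : ∀ x y → hamming x y ℕ.* D ℕ.^ 2 ℕ.≤ k ℕ.* edge x y ℕ.^ 2
  edge-bound x y = proj₂ (proj₁ (proj₂ (leastRoot x y)))

  edge≤ : ∀ x y e → 0 ℕ.< e → hamming x y ℕ.* D ℕ.^ 2 ℕ.≤ k ℕ.* e ℕ.^ 2 → edge x y ℕ.≤ e
  edge≤ x y e 0<e e-bound = proj₂ (proj₂ (leastRoot x y)) e (0<e , e-bound)

  c : Vertex k → Vertex k → ℕ
  c x y = edge x y ℕ.^ k

  c-comm : ∀ x y → c x y ≡ c y x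
  c-comm x y = cong (ℕ._^ k) (ℕₚ.≤-antisym (half x y) (half y x))
    where
    half : ∀ x y → edge x y ℕ.≤ edge y x
    half x y = edge≤ x y (edge y x) (0<edge y x)
      (subst (λ h → h ℕ.* D ℕ.^ 2 ℕ.≤ k ℕ.* edge y x ℕ.^ 2) (hamming-comm y x) (edge-bound y x))

  c≤M : ∀ x y → c x y ℕ.≤ M
  c≤M x y = ℕₚ.^-monoˡ-≤ k (edge≤ x y D (proj₁ (Root-D x y)) (proj₂ (Root-D x y)))

  -- (1 − 1/k)^{k/2} ≤ (1 − 1/2k)^k ≤ 2/3

  c-nonantipodal : ∀ x y → hamming x y ≢ k → 3 ℕ.* c x y ℕ.≤ 2 ℕ.* M
  c-nonantipodal x y h≢k = begin
    3 ℕ.* c x y              ≤⟨ ℕₚ.*-monoʳ-≤ 3 (ℕₚ.^-monoˡ-≤ k (edge≤ x y b (s≤s z≤n) bound)) ⟩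
    3 ℕ.* b ℕ.^ k            ≡⟨⟩
    p ℕ.+ (p ℕ.+ (p ℕ.+ 0))  ≡⟨ solve 1 (λ p → con 3 :* p := con 2 :* p :+ p) refl p ⟩
    2 ℕ.* p ℕ.+ p            ≤⟨ ℕₚ.+-monoʳ-≤ (2 ℕ.* p) p≤ ⟩
    2 ℕ.* p ℕ.+ 2 ℕ.* (k ℕ.* 20 ℕ.* b ℕ.^ k′) ≡⟨ ℕₚ.*-distribˡ-+ 2 p _ ⟨
    2 ℕ.* (p ℕ.+ k ℕ.* 20 ℕ.* b ℕ.^ k′)       ≤⟨ ℕₚ.*-monoʳ-≤ 2 (bernoulli b 20 k′) ⟩
    2 ℕ.* (b ℕ.+ 20) ℕ.^ k
      ≡⟨ cong (λ d → 2 ℕ.* d ℕ.^ k) (solve 1 (λ m → con 20 :+ m :* con 40 :+ con 20 := (con 1 :+ m) :* con 2 :* con 20) refl k′) ⟩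
    2 ℕ.* M                  ∎
    where
    open ℕₚ.≤-Reasoning
    open +-*-Solver
    -- This is D - 20, or D (1 - 1/(2k)); k b² exceeds (k - 1) D² by exactly 400 k.
    b = 20 ℕ.+ k′ ℕ.* 40
    p = b ℕ.^ k
    bound : hamming x y ℕ.* D ℕ.^ 2 ℕ.≤ k ℕ.* b ℕ.^ 2
    bound = begin
      hamming x y ℕ.* D ℕ.^ 2    ≤⟨ ℕₚ.*-monoˡ-≤ (D ℕ.^ 2) (ℕ.s≤s⁻¹ (ℕₚ.≤∧≢⇒< (hamming≤ x y) h≢k)) ⟩
      k′ ℕ.* D ℕ.^ 2             ≤⟨ ℕₚ.m≤m+n _ (k ℕ.* 400) ⟩
      k′ ℕ.* D ℕ.^ 2 ℕ.+ k ℕ.* 400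
        ≡⟨ solve 1 (λ m → let k = con 1 :+ m; d = k :* con 2 :* con 20; b = con 20 :+ m :* con 40 in
             m :* (d :* (d :* con 1)) :+ k :* con 400 := k :* (b :* (b :* con 1))) refl k′ ⟩
      k ℕ.* b ℕ.^ 2              ∎
    -- Since b + 20 = D = 2 · 20 k, the linear term in Bernoulli's inequality is at least p/2,
    -- whence D^k ≥ 3p/2.
    p≤ : p ℕ.≤ 2 ℕ.* (k ℕ.* 20 ℕ.* b ℕ.^ k′)
    p≤ = begin
      b ℕ.* b ℕ.^ k′                    ≤⟨ ℕₚ.*-monoˡ-≤ (b ℕ.^ k′) (ℕₚ.m≤m+n b 20) ⟩
      (b ℕ.+ 20) ℕ.* b ℕ.^ k′
        ≡⟨ solve 2 (λ m q → (con 20 :+ m :* con 40 :+ con 20) :* q := con 2 :* ((con 1 :+ m) :* con 20 :* q)) refl k′ (b ℕ.^ k′) ⟩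
      2 ℕ.* (k ℕ.* 20 ℕ.* b ℕ.^ k′)     ∎

  -- The claimed bound is D · ρ i / 20, so this is `ρ-dist` rescaled.
  edge≤ρ : ∀ i x y → 9 ℕ.* hamming x y ℕ.≤ (6 ℕ.∸ toℕ i) ℕ.* k → edge x y ℕ.≤ k ℕ.* 2 ℕ.* ρ i
  edge≤ρ i x y 9h≤ = edge≤ x y (k ℕ.* 2 ℕ.* ρ i)
    (ℕₚ.*-mono-< {0} {k ℕ.* 2} (s≤s z≤n) (proj₁ (0<ρ≤20 i)))
    (ℕₚ.*-cancelˡ-≤ 9 (begin
      9 ℕ.* (h ℕ.* D ℕ.^ 2)                        ≡⟨ ℕₚ.*-assoc 9 h (D ℕ.^ 2) ⟨
      9 ℕ.* h ℕ.* D ℕ.^ 2                          ≤⟨ ℕₚ.*-monoˡ-≤ (D ℕ.^ 2) 9h≤ ⟩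
      t ℕ.* k ℕ.* D ℕ.^ 2
        ≡⟨ solve 2 (λ t k → let d = k :* con 2 :* con 20 in
             t :* k :* (d :* (d :* con 1)) := con 400 :* t :* (con 4 :* (k :* k :* k))) refl t k ⟩
      400 ℕ.* t ℕ.* (4 ℕ.* (k ℕ.* k ℕ.* k))        ≤⟨ ℕₚ.*-monoˡ-≤ (4 ℕ.* (k ℕ.* k ℕ.* k)) (ρ-dist i) ⟩
      9 ℕ.* ρ i ℕ.^ 2 ℕ.* (4 ℕ.* (k ℕ.* k ℕ.* k))
        ≡⟨ solve 2 (λ r k → let d = k :* con 2 :* r in
             con 9 :* (r :* (r :* con 1)) :* (con 4 :* (k :* k :* k)) := con 9 :* (k :* (d :* (d :* con 1)))) refl (ρ i) k ⟩
      9 ℕ.* (k ℕ.* (k ℕ.* 2 ℕ.* ρ i) ℕ.^ 2)        ∎))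
    where
    open ℕₚ.≤-Reasoning
    open +-*-Solver
    h = hamming x y
    t = 6 ℕ.∸ toℕ i

  open PathCost c c-comm public

  -- Merging in six stages down to two paths

  module _ (960≤k : 960 ℕ.≤ k) where

    private
      q s q₁ : ℕ
      q  = k ℕ./ 6
      s  = k ℕ.% 6
      -- Rounded up so that 6 q₁ ≥ k, while 5 q₁ ≤ k still holds and `close-pair` applies at every
      -- stage.
      q₁ = suc q

      k≡ : k ≡ s ℕ.+ 6 ℕ.* q
      k≡ = trans (DivMod.m≡m%n+[m/n]*n k 6) (cong (s ℕ.+_) (ℕₚ.*-comm q 6))

      160≤q : 160 ℕ.≤ q
      160≤q = DivMod./-monoˡ-≤ 6 960≤k

      k≤6q₁ : k ℕ.≤ 6 ℕ.* q₁
      k≤6q₁ = begin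
        k                  ≡⟨ k≡ ⟩
        s ℕ.+ 6 ℕ.* q      ≤⟨ ℕₚ.+-monoˡ-≤ (6 ℕ.* q) (ℕₚ.<⇒≤ (DivMod.m%n<n k 6)) ⟩
        6 ℕ.+ 6 ℕ.* q      ≡⟨ ℕₚ.*-suc 6 q ⟨
        6 ℕ.* q₁           ∎
        where
        open ℕₚ.≤-Reasoning

      iq₁≤k : ∀ (i : Fin 6) → toℕ i ℕ.* q₁ ℕ.≤ k
      iq₁≤k i = begin
        toℕ i ℕ.* q₁       ≤⟨ ℕₚ.*-monoˡ-≤ q₁ (ℕ.s≤s⁻¹ (Finₚ.toℕ<n i)) ⟩
        5 ℕ.* q₁           ≡⟨ ℕₚ.*-suc 5 q ⟩
        5 ℕ.+ 5 ℕ.* q      ≤⟨ ℕₚ.+-monoˡ-≤ (5 ℕ.* q) (ℕₚ.≤-trans (ℕₚ.m≤m+n 5 155) 160≤q) ⟩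
        q ℕ.+ 5 ℕ.* q      ≤⟨ ℕₚ.m≤n+m (6 ℕ.* q) s ⟩
        s ℕ.+ 6 ℕ.* q      ≡⟨ k≡ ⟨
        k                  ∎
        where
        open ℕₚ.≤-Reasoning

      -- Three times the hypothesis is 9h + 6 i q₁ ≤ 6k, and 6 q₁ ≥ k turns it into 9h ≤ (6 - i) k.
      close-edge : ∀ (i : Fin 6) (x y : Vertex k) →
        3 ℕ.* hamming x y ℕ.+ 2 ℕ.* (toℕ i ℕ.* q₁) ℕ.≤ 2 ℕ.* k →
        c x y ℕ.≤ (k ℕ.* 2 ℕ.* ρ i) ℕ.^ k
      close-edge i x y close = ℕₚ.^-monoˡ-≤ k (edge≤ρ i x y
        (subst (9 ℕ.* h ℕ.≤_) (sym (ℕₚ.*-distribʳ-∸ k 6 (toℕ i)))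
          (ℕₚ.m+n≤o⇒m≤o∸n (9 ℕ.* h) (begin
            9 ℕ.* h ℕ.+ toℕ i ℕ.* k             ≤⟨ ℕₚ.+-monoʳ-≤ (9 ℕ.* h) (ℕₚ.*-monoʳ-≤ (toℕ i) k≤6q₁) ⟩
            9 ℕ.* h ℕ.+ toℕ i ℕ.* (6 ℕ.* q₁)
              ≡⟨ solve 3 (λ h i q → con 9 :* h :+ i :* (con 6 :* q) := con 3 :* (con 3 :* h :+ con 2 :* (i :* q))) refl h (toℕ i) q₁ ⟩
            3 ℕ.* (3 ℕ.* h ℕ.+ 2 ℕ.* (toℕ i ℕ.* q₁)) ≤⟨ ℕₚ.*-monoʳ-≤ 3 close ⟩
            3 ℕ.* (2 ℕ.* k)                     ≡⟨ ℕₚ.*-assoc 3 2 k ⟨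
            6 ℕ.* k                             ∎))))
        where
        open ℕₚ.≤-Reasoning
        open +-*-Solver
        h = hamming x y

      -- Each of the six stages costs at most M/18, so that the two paths left at
      -- the end cost at most M/3; the closing edges may then cost 5M/3.

      stage-cost : ∀ (i : Fin 6) →
        18 ℕ.* (2 ℕ.^ suc (suc (toℕ i) ℕ.* q₁) ℕ.* (k ℕ.* 2 ℕ.* ρ i) ℕ.^ k) ℕ.≤ M
      stage-cost i = stage-power 18 2304 (suc (toℕ i)) {20} {19} {ρ i} (k ℕ.* 2) q s k k≡
        (36·2^≤ i) (ρ-power i) (proj₂ (0<ρ≤20 i))
        (geometric {2304} {19} {20} {160} (ℕₚ.n≤1+n 19) 2304·19^160≤20^160 q 160≤q)

    -- Here `i` counts the stages to go. The case `suc i` merges from at most 2 · 2^((i+1) q₁) paths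
    -- down to 2 · 2^(i q₁) with edges bounded through `ρ` at index `i`, and pays at most M/18.
    stages : ∀ i → i ℕ.≤ 6 → ∀ F → 2 ℕ.≤ length F → length F ℕ.≤ 2 ℕ.^ suc (i ℕ.* q₁) →
      ∃[ G ] (concatMap verts G ↭ concatMap verts F × length G ≡ 2 ×
              18 ℕ.* forestCost G ℕ.≤ 18 ℕ.* forestCost F ℕ.+ i ℕ.* M)
    stages zero    _   F 2≤|F| |F|≤2 =
      F , ↭-refl , ℕₚ.≤-antisym |F|≤2 2≤|F| , ℕₚ.m≤m+n _ _
    stages (suc i) i<6 F 2≤|F| |F|≤N =
      let (G , G↭ , 2≤|G| , |G|≤ , cost≤) = merge (2 ℕ.^ suc (i ℕ.* q₁)) B
            (ℕₚ.*-monoʳ-≤ 2 (ℕₚ.m^n>0 2 (i ℕ.* q₁))) close N F |F|≤N 2≤|F|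
          (G′ , G′↭ , |G′| , cost′≤) = stages i (ℕₚ.<⇒≤ i<6) G 2≤|G| |G|≤
      in G′ , ↭-trans G′↭ G↭ , |G′| , (begin
        18 ℕ.* forestCost G′                              ≤⟨ cost′≤ ⟩
        18 ℕ.* forestCost G ℕ.+ i ℕ.* M                   ≤⟨ ℕₚ.+-monoˡ-≤ (i ℕ.* M) (ℕₚ.*-monoʳ-≤ 18 cost≤) ⟩
        18 ℕ.* (forestCost F ℕ.+ N ℕ.* B) ℕ.+ i ℕ.* M
          ≡⟨ trans (cong (ℕ._+ i ℕ.* M) (ℕₚ.*-distribˡ-+ 18 (forestCost F) (N ℕ.* B)))
                   (ℕₚ.+-assoc (18 ℕ.* forestCost F) (18 ℕ.* (N ℕ.* B)) (i ℕ.* M)) ⟩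
        18 ℕ.* forestCost F ℕ.+ (18 ℕ.* (N ℕ.* B) ℕ.+ i ℕ.* M)
          ≤⟨ ℕₚ.+-monoʳ-≤ (18 ℕ.* forestCost F) (ℕₚ.+-monoˡ-≤ (i ℕ.* M)
               (subst (λ j → 18 ℕ.* (2 ℕ.^ suc (suc j ℕ.* q₁) ℕ.* B) ℕ.≤ M) toℕ-i (stage-cost i′))) ⟩
        18 ℕ.* forestCost F ℕ.+ (M ℕ.+ i ℕ.* M)           ∎)
      where
      open ℕₚ.≤-Reasoning
      i′ : Fin 6
      i′ = fromℕ< i<6
      toℕ-i : toℕ i′ ≡ i
      toℕ-i = Finₚ.toℕ-fromℕ< i<6
      N B : ℕ
      N = 2 ℕ.^ suc (suc i ℕ.* q₁)
      B = (k ℕ.* 2 ℕ.* ρ i′) ℕ.^ k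
      close : ∀ F → 2 ℕ.^ suc (i ℕ.* q₁) ℕ.< length F → ∃[ P ] ∃[ Q ] ∃[ R ]
              (F ↭ P ∷ Q ∷ R × c (proj₁ P) (proj₁ Q) ℕ.≤ B)
      close F lt =
        let (P , Q , R , F↭ , h≤) = close-pair (toℕ i′ ℕ.* q₁) proj₁ (iq₁≤k i′) F
              (subst (λ j → 2 ℕ.^ suc (j ℕ.* q₁) ℕ.< length F) (sym toℕ-i) lt)
        in P , Q , R , F↭ , close-edge i′ (proj₁ P) (proj₁ Q) h≤

    -- One-point paths cost nothing, and 2^k bounds their number within the range of the first
    -- stage. The six stages add at most 6M/18 = M/3.
    two-paths : ∀ X → Unique X → 2 ℕ.≤ length X →
      ∃[ P ] ∃[ Q ] (verts P ++ verts Q ↭ X × 3 ℕ.* (cost P ℕ.+ cost Q) ℕ.≤ M)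
    two-paths X uni 2≤|X| = last-two (stages 6 ℕₚ.≤-refl F₀ (subst (2 ℕ.≤_) (sym |F₀|) 2≤|X|) (begin
      length F₀                  ≡⟨ |F₀| ⟩
      length X                   ≤⟨ Unique⇒length≤2^ X uni ⟩
      2 ℕ.^ k                    ≤⟨ ℕₚ.^-monoʳ-≤ 2 (ℕₚ.m≤n⇒m≤1+n k≤6q₁) ⟩
      2 ℕ.^ suc (6 ℕ.* q₁)       ∎))
      where
      open ℕₚ.≤-Reasoning
      F₀ : List (Path (Vertex k))
      F₀ = map (_, []) X
      |F₀| : length F₀ ≡ length X
      |F₀| = Listₚ.length-map (_, []) X
      verts-singletons : ∀ (X : List (Vertex k)) → concatMap verts (map (_, []) X) ≡ X
      verts-singletons []      = refl
      verts-singletons (x ∷ X) = cong (x ∷_) (verts-singletons X)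
      cost-singletons : ∀ X → forestCost (map (_, []) X) ≡ 0
      cost-singletons []      = refl
      cost-singletons (x ∷ X) = cost-singletons X
      last-two : ∃[ G ] (concatMap verts G ↭ concatMap verts F₀ × length G ≡ 2 ×
                         18 ℕ.* forestCost G ℕ.≤ 18 ℕ.* forestCost F₀ ℕ.+ 6 ℕ.* M) →
                 ∃[ P ] ∃[ Q ] (verts P ++ verts Q ↭ X × 3 ℕ.* (cost P ℕ.+ cost Q) ℕ.≤ M)
      last-two (P ∷ Q ∷ [] , G↭ , refl , cost≤) = P , Q ,
        ↭-trans (↭-reflexive (cong (verts P ++_) (sym (Listₚ.++-identityʳ (verts Q)))))
          (↭-trans G↭ (↭-reflexive (verts-singletons X))) ,
        ℕₚ.*-cancelˡ-≤ 6 (begin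
          6 ℕ.* (3 ℕ.* (cost P ℕ.+ cost Q))       ≡⟨ ℕₚ.*-assoc 6 3 (cost P ℕ.+ cost Q) ⟨
          18 ℕ.* (cost P ℕ.+ cost Q)              ≡⟨ cong (λ w → 18 ℕ.* (cost P ℕ.+ w)) (ℕₚ.+-identityʳ (cost Q)) ⟨
          18 ℕ.* forestCost (P ∷ Q ∷ [])          ≤⟨ cost≤ ⟩
          18 ℕ.* forestCost F₀ ℕ.+ 6 ℕ.* M        ≡⟨ cong (λ w → 18 ℕ.* w ℕ.+ 6 ℕ.* M) (cost-singletons X) ⟩
          6 ℕ.* M                                 ∎)

  -- Closing up the last two paths

  pair≤ : ∀ x y z w → hamming x y ≢ k → 3 ℕ.* (c x y ℕ.+ c z w) ℕ.≤ 5 ℕ.* M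
  pair≤ x y z w h≢k = begin
    3 ℕ.* (c x y ℕ.+ c z w)           ≡⟨ ℕₚ.*-distribˡ-+ 3 (c x y) (c z w) ⟩
    3 ℕ.* c x y ℕ.+ 3 ℕ.* c z w       ≤⟨ ℕₚ.+-mono-≤ (c-nonantipodal x y h≢k) (ℕₚ.*-monoʳ-≤ 3 (c≤M z w)) ⟩
    2 ℕ.* M ℕ.+ 3 ℕ.* M               ≡⟨ ℕₚ.*-distribʳ-+ M 2 3 ⟨
    5 ℕ.* M                           ∎
    where
    open ℕₚ.≤-Reasoning

  pair≤′ : ∀ x y z w → hamming z w ≢ k → 3 ℕ.* (c x y ℕ.+ c z w) ℕ.≤ 5 ℕ.* M
  pair≤′ x y z w h≢k =
    subst (λ t → 3 ℕ.* t ℕ.≤ 5 ℕ.* M) (ℕₚ.+-comm (c z w) (c x y)) (pair≤ z w x y h≢k)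

  close-up : ∀ p e → 3 ℕ.* p ℕ.≤ M → 3 ℕ.* e ℕ.≤ 5 ℕ.* M → p ℕ.+ e ℕ.≤ 2 ℕ.* M
  close-up p e p≤ e≤ = ℕₚ.*-cancelˡ-≤ 3 (begin
    3 ℕ.* (p ℕ.+ e)           ≡⟨ ℕₚ.*-distribˡ-+ 3 p e ⟩
    3 ℕ.* p ℕ.+ 3 ℕ.* e       ≤⟨ ℕₚ.+-mono-≤ p≤ e≤ ⟩
    6 ℕ.* M                   ≡⟨ ℕₚ.*-assoc 3 2 M ⟩
    3 ℕ.* (2 ℕ.* M)           ∎)
    where
    open ℕₚ.≤-Reasoning

  -- The end of a longer path is a later vertex, hence different from the first. The suffix `ys`
  -- lets this apply to a path inside a longer list of distinct vertices.
  end≡start⇒[] : ∀ x (xs {ys} : List (Vertex k)) → Unique (x ∷ xs ++ ys) → end x xs ≡ x → xs ≡ []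
  end≡start⇒[] x []       _         _  = refl
  end≡start⇒[] x (z ∷ zs) (x∉ ∷ _) eq = contradiction (sym eq) (fresh z zs x∉)
    where
    fresh : ∀ z zs {ys} → All (x ≢_) (z ∷ zs ++ ys) → x ≢ end z zs
    fresh z []       (x≢z ∷ _) = x≢z
    fresh z (w ∷ zs) (_ ∷ x∉)  = fresh w zs x∉

  -- A way of closing up costs at most 5M/3 unless both of its edges are antipodal; with M/3 for the
  -- paths this gives 2M.
  join-paths : ∀ x xs y ys → Unique (x ∷ xs ++ y ∷ ys) →
    3 ℕ.* (pathCost x xs ℕ.+ pathCost y ys) ℕ.≤ M →
    ∃[ T ] (T ↭ x ∷ xs ++ y ∷ ys × tourCost T ℕ.≤ 2 ℕ.* M)
  join-paths x xs y ys uni paths≤ = choose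
    (hamming p r ℕₚ.≟ k) (hamming x y ℕₚ.≟ k) (hamming p y ℕₚ.≟ k) (hamming x r ℕₚ.≟ k)
    where
    open ℕₚ.≤-Reasoning
    p = end x xs
    r = end y ys
    Result = ∃[ T ] (T ↭ x ∷ xs ++ y ∷ ys × tourCost T ℕ.≤ 2 ℕ.* M)

    crossed : 3 ℕ.* (c p r ℕ.+ c x y) ℕ.≤ 5 ℕ.* M → Result
    crossed e≤ = x ∷ xs ++ verts (revOnto y ys []) ,
      ↭ₚ.++⁺ˡ (x ∷ xs) (↭-trans (verts-revOnto y ys []) (↭-reflexive (Listₚ.++-identityʳ (y ∷ ys)))) ,
      subst (ℕ._≤ 2 ℕ.* M) (sym (tourCost-reverse-join x xs y ys))
        (close-up (pathCost x xs ℕ.+ pathCost y ys) (c p r ℕ.+ c x y) paths≤ e≤)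

    straight : 3 ℕ.* (c p y ℕ.+ c x r) ℕ.≤ 5 ℕ.* M → Result
    straight e≤ = x ∷ xs ++ y ∷ ys , ↭-refl ,
      subst (ℕ._≤ 2 ℕ.* M) (sym (tourCost-join x xs y ys))
        (close-up (pathCost x xs ℕ.+ pathCost y ys) (c p y ℕ.+ c x r) paths≤ e≤)

    -- The paths themselves cost nothing here, so the whole budget 2M is available for the segment
    -- counted twice.
    singletons : xs ≡ [] → ys ≡ [] → Result
    singletons refl refl = x ∷ y ∷ [] , ↭-refl , (begin
      tourCost (x ∷ y ∷ [])     ≡⟨ tourCost-join x [] y [] ⟩
      c x y ℕ.+ c x y           ≤⟨ ℕₚ.+-mono-≤ (c≤M x y) (c≤M x y) ⟩
      M ℕ.+ M                   ≡⟨ cong (M ℕ.+_) (ℕₚ.+-identityʳ M) ⟨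
      2 ℕ.* M                   ∎)

    choose : Dec (hamming p r ≡ k) → Dec (hamming x y ≡ k) →
             Dec (hamming p y ≡ k) → Dec (hamming x r ≡ k) → Result
    choose (no pr≢k) _ _ _ = crossed (pair≤ p r x y pr≢k)
    choose _ (no xy≢k) _ _ = crossed (pair≤′ p r x y xy≢k)
    choose _ _ (no py≢k) _ = straight (pair≤ p y x r py≢k)
    choose _ _ _ (no xr≢k) = straight (pair≤′ p y x r xr≢k)
    -- Both `p` and `x` are antipodes of `y`, and both `r` and `y` are antipodes of `p`. Hence p = x
    -- and r = y, and each path is a single point.
    choose (yes pr≡k) (yes xy≡k) (yes py≡k) (yes xr≡k) = singletons
      (end≡start⇒[] x xs uni (antipode-unique y p x
        (trans (hamming-comm y p) py≡k) (trans (hamming-comm y x) xy≡k)))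
      (end≡start⇒[] y ys (Unique-resp-↭ (↭ₚ.++-comm (x ∷ xs) (y ∷ ys)) uni)
        (antipode-unique p r y pr≡k py≡k))

  joined-tour : ∀ {X} → Unique X →
    ∃[ P ] ∃[ Q ] (verts P ++ verts Q ↭ X × 3 ℕ.* (cost P ℕ.+ cost Q) ℕ.≤ M) →
    ∃[ H ] (tourCost (tour {X = X} H) ℕ.≤ 2 ℕ.* M)
  joined-tour uni ((x , xs) , (y , ys) , PQ↭X , paths≤) =
    let (T , T↭PQ , cost≤) = join-paths x xs y ys (Unique-resp-↭ (↭-sym PQ↭X) uni) paths≤
    in record { tour = T ; tour↭X = ↭-trans T↭PQ PQ↭X } , cost≤

  tourCost⇒scaledCost : ∀ {X} → ∃[ H ] (tourCost (tour {X = X} H) ℕ.≤ 2 ℕ.* M) →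
    ∃[ H ] (scaledCost {k} {X} H ≤ root k (fromℕ 2) * √ (fromℕ k))
  tourCost⇒scaledCost (H , cost≤) = H , scaledCost-bound H D edge 0<edge edge-bound cost≤

  short-tour : 960 ℕ.≤ k → ∀ X → Unique X → 2 ℕ.≤ length X →
    ∃[ H ] (scaledCost {k} {X} H ≤ root k (fromℕ 2) * √ (fromℕ k))
  short-tour 960≤k X uni 2≤|X| =
    tourCost⇒scaledCost (joined-tour uni (two-paths 960≤k X uni 2≤|X|))

theorem1p4 : ∃[ k₀ ] (∀ (k : ℕ) .{{_ : NonZero k}} → k₀ ℕ.≤ k →
    ∀ (X : List (Vertex k)) → Unique X → 2 ℕ.≤ length X →
    ∃[ H ] (scaledCost {k} {X} H ≤ root k (fromℕ 2) * √ (fromℕ k)))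
theorem1p4 = 960 , λ { (suc k′) → Weights.short-tour k′ }
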